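{- Let $G$ be a finite loopless multigraph of maximum degree at most $3$, each of whose edges is of one of two types, c-edges and d-edges (a pair of vertices may be joined both by a c-edge and by a d-edge). If $G$ does not contain a connected component isomorphic to $K_4$ all of whose edges are c-edges, then $G$ has a $2$-limited set $X$ with $|X| \geq |V(G)|/3$.
   Context: In such a two-type multigraph, the degree of a vertex counts edges of both types (and this degree is at most $3$). For a vertex $v$, its closed d-neighbourhood is $N_d[v] = \{v\} \cup \{u : uv \text{ is a d-edge}\}$. A set $X \subseteq V(G)$ is called $2$-limited if (i) for every c-edge $uv$, $|X \cap \{u,v\}| \leq 1$, and (ii) for every vertex $v$, $|X \cap N_d[v]| \leq 2$. (c-edges do not contribute to $N_d[v]$, and $X$ may contain both endpoints of a d-edge.) -}

module Defs where

open import Data.Nat using (ℕ; zero; suc; _≤_; _*_)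
open import Data.Bool using (Bool; true; false; _∨_; _∧_; if_then_else_)
open import Data.Fin using (Fin)
open import Data.Fin.Properties using (_≟_)
open import Data.Fin.Subset using (Subset; _∈_; _∩_; ∣_∣)
open import Data.List using (List; []; _∷_)
open import Data.List.Relation.Unary.All using (All)
open import Data.Vec using (tabulate)
open import Data.Product using (_×_; ∃)
open import Data.Sum using (_⊎_)
open import Relation.Nullary using (¬_)
open import Relation.Nullary.Decidable using (⌊_⌋)
open import Relation.Binary.PropositionalEquality using (_≡_; _≢_)

data EType : Set where
  c d : EType

isD : EType → Bool
isD c = false
isD d = true

record Edge (n : ℕ) : Set where
  constructor edge
  field
    end₁ : Fin n
    end₂ : Fin n
    etype : EType
open Edge public

-- A finite two-type multigraph: vertex set Fin n, edge multiset given as a list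
-- (parallel edges of any types allowed).
record Graph : Set where
  constructor graph
  field
    n : ℕ
    E : List (Edge n)
open Graph public

Loopless : Graph → Set
Loopless G = All (λ e → end₁ e ≢ end₂ e) (E G)

incident : {n : ℕ} → Edge n → Fin n → Bool
incident e v = ⌊ end₁ e ≟ v ⌋ ∨ ⌊ end₂ e ≟ v ⌋

joins : {n : ℕ} → Edge n → Fin n → Fin n → Bool
joins e u v = (⌊ end₁ e ≟ u ⌋ ∧ ⌊ end₂ e ≟ v ⌋) ∨ (⌊ end₁ e ≟ v ⌋ ∧ ⌊ end₂ e ≟ u ⌋)

count : {n : ℕ} → (Edge n → Bool) → List (Edge n) → ℕ
count p [] = 0
count p (e ∷ es) = if p e then suc (count p es) else count p es

degree : (G : Graph) → Fin (n G) → ℕ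
degree G v = count (λ e → incident e v) (E G)

MaxDegreeAtMost3 : Graph → Set
MaxDegreeAtMost3 G = (v : Fin (n G)) → degree G v ≤ 3

anyDEdge : {n : ℕ} → List (Edge n) → Fin n → Fin n → Bool
anyDEdge [] u w = false
anyDEdge (e ∷ es) u w = (isD (etype e) ∧ joins e u w) ∨ anyDEdge es u w

Nd : (G : Graph) → Fin (n G) → Subset (n G)
Nd G v = tabulate (λ w → ⌊ w ≟ v ⌋ ∨ anyDEdge (E G) v w)

TwoLimited : (G : Graph) → Subset (n G) → Set
TwoLimited G X =
  All (λ e → etype e ≡ c → ¬ (end₁ e ∈ X × end₂ e ∈ X)) (E G)
  × ((v : Fin (n G)) → ∣ X ∩ Nd G v ∣ ≤ 2)

module _ (G : Graph) where
  InFour : Fin (n G) → Fin (n G) → Fin (n G) → Fin (n G) → Fin (n G) → Set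
  InFour a b c' d' x = x ≡ a ⊎ x ≡ b ⊎ x ≡ c' ⊎ x ≡ d'

  mult : Fin (n G) → Fin (n G) → ℕ
  mult u v = count (λ e → joins e u v) (E G)

  IsCK4Component : Fin (n G) → Fin (n G) → Fin (n G) → Fin (n G) → Set
  IsCK4Component a b c' d' =
    (a ≢ b × a ≢ c' × a ≢ d' × b ≢ c' × b ≢ d' × c' ≢ d')
    × (mult a b ≡ 1 × mult a c' ≡ 1 × mult a d' ≡ 1
       × mult b c' ≡ 1 × mult b d' ≡ 1 × mult c' d' ≡ 1)
    × All (λ e → (InFour a b c' d' (end₁ e) ⊎ InFour a b c' d' (end₂ e))
                 → etype e ≡ c × InFour a b c' d' (end₁ e) × InFour a b c' d' (end₂ e))
          (E G)

HasCK4Component : Graph → Set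
HasCK4Component G =
  ∃ λ a → ∃ λ b → ∃ λ c' → ∃ λ d' → IsCK4Component G a b c' d'

{-# OPTIONS --safe #-}

-- While some d-edge ve is not parallel to a c-edge, both v and e are chosen and the at most six
-- vertices around them deleted; what remains to be respected at a deleted neighbour is recorded by
-- a new c-edge. If the new edges close up to a c-K4, then the original graph contains a small
-- nearly closed piece around that K4, from which a third of the vertices can be chosen without
-- adding edges. Once all d-edges are parallel to c-edges, an independent third of a K4-free
-- subcubic graph is needed: triangles are contracted to an edge, and in the triangle-free case
-- local search suffices, since there every chosen vertex has at most one private neighbour.
module Submission where

open import Defs
open import Data.Bool using (Bool; true; false; _∨_)
open import Data.Bool.Properties using (∨-zeroʳ)
open import Data.Empty using (⊥; ⊥-elim)
open import Data.Fin using (Fin; zero; suc)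
open import Data.Fin.Properties using (_≟_; suc-injective)
import Data.Fin.Properties as Fin
open import Data.Fin.Subset using (Subset; ∣_∣; _∩_) renaming (_∈_ to _∈ˢ_)
open import Data.Fin.Subset.Properties using (x∈p∩q⁻)
open import Data.List using (List; []; _∷_; _++_; length; filter; map; concatMap; allFin)
open import Data.List.Properties
  using (length-++; length-++-sucʳ; length-map; length-filter; length-tabulate; filter-notAll)
import Data.List.Membership.DecPropositional as DecMembership
open import Data.List.Membership.Propositional using (_∈_; _∉_; find; lose)
open import Data.List.Membership.Propositional.Properties
  using (∈-++⁺ˡ; ∈-++⁺ʳ; ∈-++⁻; ∈-∃++; ∈-filter⁺; ∈-filter⁻; ∈-map⁺; ∈-map⁻; ∈-concatMap⁺; ∈-allFin)
open import Data.List.Relation.Binary.Subset.Propositional using (_⊆_)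
open import Data.List.Relation.Unary.All as All using (All; []; _∷_; all?)
open import Data.List.Relation.Unary.All.Properties using (All¬⇒¬Any; ¬Any⇒All¬)
open import Data.List.Relation.Unary.AllPairs using ([]; _∷_)
open import Data.List.Relation.Unary.Any using (here; there; any?)
open import Data.List.Relation.Unary.Unique.Propositional using (Unique)
import Data.List.Relation.Unary.Unique.Propositional.Properties as Unique
open import Data.Maybe using (Maybe; just; nothing)
open import Data.Maybe.Properties using (just-injective)
open import Data.Nat using (ℕ; zero; suc; _+_; _*_; _≤_; _<_; z≤n; s≤s)
open import Data.Nat.Properties
  using (≤-refl; ≤-reflexive; ≤-trans; <-≤-trans; ≰⇒>; _≤?_; m≤n⇒m≤1+n; m≤m+n; +-identityʳ; +-suc; *-suc;
         +-mono-≤; +-monoʳ-≤; *-monoʳ-≤; *-assoc; *-cancelˡ-≤; *-distribˡ-+; module ≤-Reasoning)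
open import Data.Product using (Σ; ∃; _×_; _,_; proj₁; proj₂)
open import Data.Product.Properties using (≡-dec)
open import Data.Sum using (_⊎_; inj₁; inj₂)
open import Data.Unit using (⊤; tt)
import Data.Vec as Vec
open import Data.Vec using ([]; _∷_)
open import Data.Vec.Properties using (lookup∘tabulate; []=⇒lookup; lookup⇒[]=)
open import Function using (_∘_; case_of_; id)
open import Relation.Binary.Definitions using (DecidableEquality)
open import Relation.Binary.PropositionalEquality
  using (_≡_; _≢_; refl; sym; trans; cong; cong₂; subst; ≢-sym)
open import Relation.Nullary using (¬_; Dec; yes; no)
open import Relation.Nullary.Decidable
  using (⌊_⌋; ¬?; _×-dec_; _⊎-dec_; _→-dec_; map′; decidable-stable)

-- The induction carries "no c-K4 as a subgraph" instead of "no c-K4 component": in a subcubic graph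
-- the two agree, and the subgraph form passes to induced subgraphs, so only added edges can destroy
-- it. Every reduction obeys one budget: a deleted list `S` is paid for by chosen vertices `Y` with
-- `length S ≤ 3 * length Y`. The two ends of a d-edge pay for exactly themselves and four further
-- vertices. Deletion alone does not suffice, because a deleted d-neighbour of `v` or `e` may see
-- two survivors that are both chosen later. As its degree is at most three, it sees only one such
-- pair `a`, `b`, and the edge `ab` can take over the ports of `a` and `b` that led to the deleted
-- vertex. Hence no degree grows, and a new K4 is the only danger. The same overwriting of dead
-- entries keeps degrees bounded when a triangle is contracted.

private variable
  Elt : Set

-- Pigeonhole and difference for duplicate-free lists.

unique-⊆⇒length≤ : {xs ys : List Elt} → Unique xs → xs ⊆ ys → length xs ≤ length ys
unique-⊆⇒length≤ [] _ = z≤n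
unique-⊆⇒length≤ {xs = x ∷ xs} (x∉ ∷ uxs) sub with ∈-∃++ (sub (here refl))
... | as , bs , refl = ≤-trans (s≤s (unique-⊆⇒length≤ uxs sub′)) (≤-reflexive (sym (length-++-sucʳ as x bs)))
  where
  sub′ : xs ⊆ as ++ bs
  sub′ y∈ with ∈-++⁻ as (sub (there y∈))
  ... | inj₁ y∈as = ∈-++⁺ˡ y∈as
  ... | inj₂ (here refl) = ⊥-elim (All¬⇒¬Any x∉ y∈)
  ... | inj₂ (there y∈bs) = ∈-++⁺ʳ as y∈bs

-- The degree bound as a pigeonhole: many contradictions below exhibit four distinct neighbours or
-- ports at one vertex.
no-four : {xs : List Elt} {p q r s : Elt} → length xs ≤ 3 → p ∈ xs → q ∈ xs → r ∈ xs → s ∈ xs →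
          p ≢ q → p ≢ r → p ≢ s → q ≢ r → q ≢ s → r ≢ s → ⊥
no-four {xs = xs} {p} {q} {r} {s} len p∈ q∈ r∈ s∈ pq pr ps qr qs rs =
  case ≤-trans (unique-⊆⇒length≤ uniq sub) len of λ { (s≤s (s≤s (s≤s ()))) }
  where
  uniq : Unique (p ∷ q ∷ r ∷ s ∷ [])
  uniq = (pq ∷ pr ∷ ps ∷ []) ∷ (qr ∷ qs ∷ []) ∷ (rs ∷ []) ∷ [] ∷ []
  sub : p ∷ q ∷ r ∷ s ∷ [] ⊆ xs
  sub (here refl) = p∈
  sub (there (here refl)) = q∈
  sub (there (there (here refl))) = r∈
  sub (there (there (there (here refl)))) = s∈

∉⇒≢ : {x y : Elt} {xs : List Elt} → x ∉ xs → y ∈ xs → x ≢ y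
∉⇒≢ x∉ y∈ refl = x∉ y∈

module ShortLists (_≟_ : DecidableEquality Elt) where
  open DecMembership _≟_ using (_∈?_)

  only-three : {xs : List Elt} {p q r s : Elt} → length xs ≤ 3 → p ∈ xs → q ∈ xs → r ∈ xs →
               p ≢ q → p ≢ r → q ≢ r → s ∈ xs → s ∈ p ∷ q ∷ r ∷ []
  only-three {p = p} {q} {r} {s} len p∈ q∈ r∈ pq pr qr s∈ with s ∈? (p ∷ q ∷ r ∷ [])
  ... | yes s∈′ = s∈′
  ... | no s∉ = ⊥-elim (no-four len s∈ p∈ q∈ r∈ (s∉ ∘ here) (s∉ ∘ there ∘ here)
                         (s∉ ∘ there ∘ there ∘ here) pq pr qr)

  -- If `xs` has nothing besides `p` and `q`, the witness is `p` once more. Such repetitions let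
  -- vertices of small degree be treated like vertices of degree three.
  third-element : {xs : List Elt} {p q : Elt} → length xs ≤ 3 → p ∈ xs → q ∈ xs → p ≢ q →
                  ∃ λ r → r ∈ xs × xs ⊆ p ∷ q ∷ r ∷ []
  third-element {xs} {p} {q} len p∈ q∈ pq with any? (λ r → ¬? (r ∈? (p ∷ q ∷ []))) xs
  ... | yes found = let r , r∈ , r∉ = find found in
                    r , r∈ , only-three len p∈ q∈ r∈ pq (≢-sym (r∉ ∘ here)) (≢-sym (r∉ ∘ there ∘ here))
  ... | no none = p , p∈ , λ {s} s∈ → case s ∈? (p ∷ q ∷ []) of λ where
      (yes s∈′) → ∈-++⁺ˡ s∈′
      (no s∉) → ⊥-elim (none (lose s∈ s∉))

  other-elements : {xs : List Elt} {p : Elt} → length xs ≤ 3 → p ∈ xs →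
                   ∃ λ q → ∃ λ r → q ∈ xs × r ∈ xs × xs ⊆ p ∷ q ∷ r ∷ []
  other-elements {xs} {p} len p∈ with any? (λ q → ¬? (q ≟ p)) xs
  ... | yes found = let q , q∈ , qp = find found
                        r , r∈ , sub = third-element len p∈ q∈ (≢-sym qp) in
                    q , r , q∈ , r∈ , sub
  ... | no none = p , p , p∈ , p∈ , λ {s} s∈ → here (decidable-stable (s ≟ p) (none ∘ lose s∈))

  infixl 6 _∖_
  opaque
    _∖_ : List Elt → List Elt → List Elt
    xs ∖ ys = filter (λ x → ¬? (x ∈? ys)) xs

    ∈-∖⁺ : {xs ys : List Elt} {x : Elt} → x ∈ xs → x ∉ ys → x ∈ xs ∖ ys
    ∈-∖⁺ = ∈-filter⁺ _

    ∈-∖⁻ : {xs ys : List Elt} {x : Elt} → x ∈ xs ∖ ys → x ∈ xs × x ∉ ys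
    ∈-∖⁻ = ∈-filter⁻ _

    ∖-unique : {xs ys : List Elt} → Unique xs → Unique (xs ∖ ys)
    ∖-unique = Unique.filter⁺ _

    ∖-shrinks : {xs ys : List Elt} {x : Elt} → x ∈ xs → x ∈ ys → length (xs ∖ ys) < length xs
    ∖-shrinks {xs} x∈xs x∈ys = filter-notAll _ xs (lose x∈xs (λ x∉ → x∉ x∈ys))

  -- Repetitions in `ys` and elements foreign to `xs` only enlarge the right side, so a list to be
  -- deleted may be padded or name a vertex twice.
  length-∖ : {xs ys : List Elt} → Unique xs → length xs ≤ length ys + length (xs ∖ ys)
  length-∖ {xs} {ys} uxs = ≤-trans (unique-⊆⇒length≤ uxs sub) (≤-reflexive (length-++ ys))
    where
    sub : xs ⊆ ys ++ xs ∖ ys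
    sub {x} x∈ with x ∈? ys
    ... | yes x∈ys = ∈-++⁺ˡ x∈ys
    ... | no x∉ys = ∈-++⁺ʳ ys (∈-∖⁺ x∈ x∉ys)

  record Third (xs : List Elt) (P : List Elt → Set) : Set where
    constructor third
    field
      chosen : List Elt
      unique : Unique chosen
      within : chosen ⊆ xs
      valid : P chosen
      large : length xs ≤ 3 * length chosen

  -- The bookkeeping shared by all reductions. `P′` may differ from `P` because the rest can carry
  -- modified adjacency, and `Y` may depend on `X` because a contracted triangle picks its vertex
  -- only afterwards.
  extend-third : {P P′ : List Elt → Set} {xs : List Elt} (S : List Elt) → Unique xs → Third (xs ∖ S) P′ →
    (∀ X → X ⊆ xs ∖ S → P′ X → ∃ λ Y → Unique Y × Y ⊆ S × Y ⊆ xs × length S ≤ 3 * length Y × P (Y ++ X)) →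
    Third xs P
  extend-third {xs = xs} S uxs (third X uX X⊆ pX big) ext with ext X X⊆ pX
  ... | Y , uY , Y⊆S , Y⊆xs , len , pYX = record
    { chosen = Y ++ X
    ; unique = Unique.++⁺ uY uX (λ (y∈ , x∈) → proj₂ (∈-∖⁻ (X⊆ x∈)) (Y⊆S y∈))
    ; within = λ z∈ → case ∈-++⁻ Y z∈ of λ where
        (inj₁ y∈) → Y⊆xs y∈
        (inj₂ x∈) → proj₁ (∈-∖⁻ (X⊆ x∈))
    ; valid = pYX
    ; large = begin
        length xs ≤⟨ length-∖ uxs ⟩
        length S + length (xs ∖ S) ≤⟨ +-mono-≤ len big ⟩
        3 * length Y + 3 * length X ≡⟨ *-distribˡ-+ 3 (length Y) (length X) ⟨
        3 * (length Y + length X) ≡⟨ cong (3 *_) (length-++ Y) ⟨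
        3 * length (Y ++ X) ∎
    }
    where open ≤-Reasoning

-- Independent sets

module _ {m : ℕ} where

  private
    V : Set
    V = Fin m

  open DecMembership (_≟_ {m}) using (_∈?_)
  open ShortLists (_≟_ {m})

  -- Distinctness of the corners is left to irreflexivity of `R`. Each edge is recorded in one
  -- direction, the other coming from symmetry.
  record K4 (A : List V) (R : V → V → Set) (p q r s : V) : Set where
    field
      p∈ : p ∈ A
      q∈ : q ∈ A
      r∈ : r ∈ A
      s∈ : s ∈ A
      pq : R p q
      pr : R p r
      ps : R p s
      qr : R q r
      qs : R q s
      rs : R r s

  K4Free : List V → (V → V → Set) → Set
  K4Free A R = ∀ {p q r s} → ¬ K4 A R p q r s

  SymmetricOn : List V → (V → V → Set) → Set
  SymmetricOn A R = ∀ {p q} → p ∈ A → q ∈ A → R p q → R q p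

  module _ {A : List V} {R : V → V → Set} where
    K4? : (∀ p q → Dec (R p q)) → ∀ p q r s → Dec (K4 A R p q r s)
    K4? R? p q r s = map′
      (λ (a , b , e , f , g , h , i , j , k , l) → record
        { p∈ = a ; q∈ = b ; r∈ = e ; s∈ = f ; pq = g ; pr = h ; ps = i ; qr = j ; qs = k ; rs = l })
      (λ Q → let open K4 Q in p∈ , q∈ , r∈ , s∈ , pq , pr , ps , qr , qs , rs)
      ((p ∈? A) ×-dec (q ∈? A) ×-dec (r ∈? A) ×-dec (s ∈? A) ×-dec
       R? p q ×-dec R? p r ×-dec R? p s ×-dec R? q r ×-dec R? q s ×-dec R? r s)

    has-K4? : (∀ p q → Dec (R p q)) → Dec (∃ λ p → ∃ λ q → ∃ λ r → ∃ λ s → K4 A R p q r s)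
    has-K4? R? = Fin.any? λ p → Fin.any? λ q → Fin.any? λ r → Fin.any? λ s → K4? R? p q r s

    module _ (symm : SymmetricOn A R) {p q r s : V} (Q : K4 A R p q r s) where
      open K4 Q

      K4-swap₁₂ : K4 A R q p r s
      K4-swap₁₂ = record { p∈ = q∈ ; q∈ = p∈ ; r∈ = r∈ ; s∈ = s∈ ; pq = symm p∈ q∈ pq
        ; pr = qr ; ps = qs ; qr = pr ; qs = ps ; rs = rs }

      K4-swap₂₃ : K4 A R p r q s
      K4-swap₂₃ = record { p∈ = p∈ ; q∈ = r∈ ; r∈ = q∈ ; s∈ = s∈ ; pq = pr ; pr = pq ; ps = ps
        ; qr = symm q∈ r∈ qr ; qs = rs ; rs = qs }

      K4-swap₃₄ : K4 A R p q s r
      K4-swap₃₄ = record { p∈ = p∈ ; q∈ = q∈ ; r∈ = s∈ ; s∈ = r∈ ; pq = pq ; pr = ps ; ps = pr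
        ; qr = qs ; qs = qr ; rs = symm r∈ s∈ rs }

  -- `K4Free A R` excludes six old edges; compositions of the three adjacent swaps carry a new one
  -- to the first place.
  new-edge-first : {A A′ : List V} {R R′ New : V → V → Set} → A′ ⊆ A → K4Free A R → SymmetricOn A′ R′ →
    (∀ {p q} → p ∈ A′ → q ∈ A′ → R′ p q → R p q ⊎ New p q) →
    ∀ {p q r s} → K4 A′ R′ p q r s → ∃ λ p → ∃ λ q → ∃ λ r → ∃ λ s → K4 A′ R′ p q r s × New p q
  new-edge-first sub free symm split Q
    with split (p∈ Q) (q∈ Q) (pq Q) | split (p∈ Q) (r∈ Q) (pr Q) | split (p∈ Q) (s∈ Q) (ps Q)
       | split (q∈ Q) (r∈ Q) (qr Q) | split (q∈ Q) (s∈ Q) (qs Q) | split (r∈ Q) (s∈ Q) (rs Q)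
    where open K4
  ... | inj₂ new | _ | _ | _ | _ | _ = _ , _ , _ , _ , Q , new
  ... | inj₁ _ | inj₂ new | _ | _ | _ | _ = _ , _ , _ , _ , K4-swap₂₃ symm Q , new
  ... | inj₁ _ | inj₁ _ | inj₂ new | _ | _ | _ = _ , _ , _ , _ , K4-swap₂₃ symm (K4-swap₃₄ symm Q) , new
  ... | inj₁ _ | inj₁ _ | inj₁ _ | inj₂ new | _ | _ = _ , _ , _ , _ , K4-swap₂₃ symm (K4-swap₁₂ symm Q) , new
  ... | inj₁ _ | inj₁ _ | inj₁ _ | inj₁ _ | inj₂ new | _ =
    _ , _ , _ , _ , K4-swap₂₃ symm (K4-swap₁₂ symm (K4-swap₃₄ symm Q)) , new
  ... | inj₁ _ | inj₁ _ | inj₁ _ | inj₁ _ | inj₁ _ | inj₂ new =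
    _ , _ , _ , _ , K4-swap₂₃ symm (K4-swap₁₂ symm (K4-swap₃₄ symm (K4-swap₂₃ symm Q))) , new
  ... | inj₁ a | inj₁ b | inj₁ e | inj₁ f | inj₁ g | inj₁ h = ⊥-elim (free record
    { p∈ = sub (p∈ Q) ; q∈ = sub (q∈ Q) ; r∈ = sub (r∈ Q) ; s∈ = sub (s∈ Q)
    ; pq = a ; pr = b ; ps = e ; qr = f ; qs = g ; rs = h })
    where open K4

  -- The graph is the one induced on the vertices in A; entries of N outside A are inert, so that
  -- deleting vertices leaves N unchanged.
  record Subcubic (A : List V) (N : V → List V) : Set where
    field
      degree≤3 : ∀ x → length (N x) ≤ 3
      symm : SymmetricOn A (λ x y → y ∈ N x)
      irrefl : ∀ {x} → x ∈ A → x ∉ N x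
      K4-free : K4Free A (λ x y → y ∈ N x)

  Independent : (V → List V) → List V → Set
  Independent N X = ∀ {x y} → x ∈ X → y ∈ X → y ∉ N x

  Subcubic-⊆ : ∀ {A A′ N} → A′ ⊆ A → Subcubic A N → Subcubic A′ N
  Subcubic-⊆ sub G = record
    { degree≤3 = degree≤3
    ; symm = λ x∈ y∈ → symm (sub x∈) (sub y∈)
    ; irrefl = irrefl ∘ sub
    ; K4-free = λ Q → let open K4 Q in K4-free record
        { p∈ = sub p∈ ; q∈ = sub q∈ ; r∈ = sub r∈ ; s∈ = sub s∈
        ; pq = pq ; pr = pr ; ps = ps ; qr = qr ; qs = qs ; rs = rs }
    }
    where open Subcubic G

  -- `N′` is arbitrary because contracting a triangle alters adjacency; only the number of vertices
  -- decreases.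
  Induction : List V → Set
  Induction A = ∀ A′ N′ → length A′ < length A → Unique A′ → Subcubic A′ N′ → Third A′ (Independent N′)

  module _ {A : List V} {N : V → List V} (unique : Unique A) (G : Subcubic A N) (IH : Induction A) where
    open Subcubic G

    -- No survivor is adjacent to `Y`, so `Y` can join any independent set of the rest.
    delete-closed : (S Y : List V) → Unique Y → Y ⊆ S → Y ⊆ A → ∃ (_∈ Y) → length S ≤ 3 * length Y →
      Independent N Y → (∀ {y z} → y ∈ Y → z ∈ A ∖ S → z ∉ N y) → Third A (Independent N)
    delete-closed S Y uY Y⊆S Y⊆A (_ , y∈) len indY closed =
      extend-third S unique
        (IH _ N (∖-shrinks (Y⊆A y∈) (Y⊆S y∈)) (∖-unique unique) (Subcubic-⊆ (proj₁ ∘ ∈-∖⁻) G))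
        (λ X X⊆ indX → Y , uY , Y⊆S , Y⊆A , len , λ a∈ b∈ → case ∈-++⁻ Y a∈ , ∈-++⁻ Y b∈ of λ where
          (inj₁ a∈Y , inj₁ b∈Y) → indY a∈Y b∈Y
          (inj₁ a∈Y , inj₂ b∈X) → closed a∈Y (X⊆ b∈X)
          (inj₂ a∈X , inj₁ b∈Y) b∈N → closed b∈Y (X⊆ a∈X)
            (symm (proj₁ (∈-∖⁻ (X⊆ a∈X))) (Y⊆A b∈Y) b∈N)
          (inj₂ a∈X , inj₂ b∈X) → indX a∈X b∈X)

  -- The edge `x′y′` is written over entries that die with `x` and `y`: over `x` in the list of `x′`
  -- and over `y` in the list of `y′`. All lists keep their lengths, which preserves the degree
  -- bound.
  module Link (N : V → List V) (x y x′ y′ : V) where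
    redirect : V → V → V
    redirect s p with (s ≟ x′) ×-dec (p ≟ x) | (s ≟ y′) ×-dec (p ≟ y)
    ... | yes _ | _ = y′
    ... | no _ | yes _ = x′
    ... | no _ | no _ = p

    linked : V → List V
    linked s = map (redirect s) (N s)

    linked-old : ∀ {s p} → p ∈ N s → p ≢ x → p ≢ y → p ∈ linked s
    linked-old {s} {p} p∈ p≢x p≢y = subst (_∈ linked s) fixed (∈-map⁺ (redirect s) p∈)
      where
      fixed : redirect s p ≡ p
      fixed with (s ≟ x′) ×-dec (p ≟ x) | (s ≟ y′) ×-dec (p ≟ y)
      ... | yes (_ , e) | _ = ⊥-elim (p≢x e)
      ... | no _ | yes (_ , e) = ⊥-elim (p≢y e)
      ... | no _ | no _ = refl

    linked-new₁ : x ∈ N x′ → y′ ∈ linked x′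
    linked-new₁ x∈ = subst (_∈ linked x′) moved (∈-map⁺ (redirect x′) x∈)
      where
      moved : redirect x′ x ≡ y′
      moved with (x′ ≟ x′) ×-dec (x ≟ x) | (x′ ≟ y′) ×-dec (x ≟ y)
      ... | yes _ | _ = refl
      ... | no ne | _ = ⊥-elim (ne (refl , refl))

    linked-new₂ : x′ ≢ y′ → y ∈ N y′ → x′ ∈ linked y′
    linked-new₂ x′≢y′ y∈ = subst (_∈ linked y′) moved (∈-map⁺ (redirect y′) y∈)
      where
      moved : redirect y′ y ≡ x′
      moved with (y′ ≟ x′) ×-dec (y ≟ x) | (y′ ≟ y′) ×-dec (y ≟ y)
      ... | yes (e , _) | _ = ⊥-elim (x′≢y′ (sym e))
      ... | no _ | yes _ = refl
      ... | no _ | no ne = ⊥-elim (ne (refl , refl))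

    IsLink : V → V → Set
    IsLink s p = (s ≡ x′ × p ≡ y′) ⊎ (s ≡ y′ × p ≡ x′)

    linked-split : ∀ {s p} → p ∈ linked s → p ∈ N s ⊎ IsLink s p
    linked-split {s} p∈ with ∈-map⁻ (redirect s) p∈
    ... | p₀ , p₀∈ , refl with (s ≟ x′) ×-dec (p₀ ≟ x) | (s ≟ y′) ×-dec (p₀ ≟ y)
    ... | yes (e , _) | _ = inj₂ (inj₁ (e , refl))
    ... | no _ | yes (e , _) = inj₂ (inj₂ (e , refl))
    ... | no _ | no _ = inj₁ p₀∈

  -- Reductions at a triangle.

  module _ {A : List V} {N : V → List V} (unique : Unique A) (G : Subcubic A N) (IH : Induction A) where
    open Subcubic G

    record Triangle (x y z : V) : Set where
      field
        x∈ : x ∈ A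
        y∈ : y ∈ A
        z∈ : z ∈ A
        xy : y ∈ N x
        xz : z ∈ N x
        yz : z ∈ N y

    rotate : ∀ {x y z} → Triangle x y z → Triangle y z x
    rotate T = record { x∈ = y∈ ; y∈ = z∈ ; z∈ = x∈ ; xy = yz ; xz = symm x∈ y∈ xy ; yz = symm x∈ z∈ xz }
      where open Triangle T

    reflect : ∀ {x y z} → Triangle x y z → Triangle x z y
    reflect T = record { x∈ = x∈ ; y∈ = z∈ ; z∈ = y∈ ; xy = xz ; xz = xy ; yz = symm y∈ z∈ yz }
      where open Triangle T

    -- `x′` may coincide with `y` or `z`, or lie outside `A`. In each of these cases it is missing
    -- from `A ∖ (x ∷ y ∷ z ∷ [])`, and `dangling-triangle` applies.
    Third-neighbour : V → V → V → V → Set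
    Third-neighbour x y z x′ = x′ ∈ N x × N x ⊆ y ∷ z ∷ x′ ∷ []

    adjacent-≢ : ∀ {x y} → x ∈ A → y ∈ N x → x ≢ y
    adjacent-≢ x∈ y∈ refl = irrefl x∈ y∈

    third-neighbour : ∀ {x y z} → Triangle x y z → ∃ (Third-neighbour x y z)
    third-neighbour T = third-element (degree≤3 _) xy xz (adjacent-≢ y∈ yz)
      where open Triangle T

    private
      singleton : ∀ {x : V} → Unique (x ∷ [])
      singleton = [] ∷ []

    -- All live neighbours of `x` lie in the triangle, so `x` alone pays for its three vertices.
    dangling-triangle : ∀ {x y z x′} → Triangle x y z → Third-neighbour x y z x′ →
      x′ ∉ A ∖ (x ∷ y ∷ z ∷ []) → Third A (Independent N)
    dangling-triangle {x} {y} {z} {x′} T (_ , only) x′∉ = delete-closed unique G IH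
      (x ∷ y ∷ z ∷ []) (x ∷ []) singleton (λ { (here refl) → here refl }) (λ { (here refl) → x∈ })
      (x , here refl) ≤-refl (λ { (here refl) (here refl) → irrefl x∈ })
      λ { (here refl) p∈ p∈N → case only p∈N of λ where
            (here refl) → proj₂ (∈-∖⁻ p∈) (there (here refl))
            (there (here refl)) → proj₂ (∈-∖⁻ p∈) (there (there (here refl)))
            (there (there (here refl))) → x′∉ p∈ }
      where open Triangle T

    -- `z` and `w` are non-adjacent, or `x`, `y`, `z`, `w` would form a K4. Each has at most one
    -- neighbour besides `x` and `y`, so choosing both costs six deletions.
    diamond : ∀ {x y z w z′} → Triangle x y z → Third-neighbour z x y z′ →
      w ∈ A ∖ (x ∷ y ∷ z ∷ []) → w ∈ N x → w ∈ N y → Third A (Independent N)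
    diamond {x} {y} {z} {w} {z′} T (_ , z-only) w∈′ xw yw
      with third-element (degree≤3 w) (symm x∈ w∈ xw) (symm y∈ w∈ yw) (adjacent-≢ x∈ xy)
      where
      open Triangle T
      w∈ = proj₁ (∈-∖⁻ w∈′)
    ... | w′ , _ , w-only = delete-closed unique G IH
      (x ∷ y ∷ z ∷ w ∷ z′ ∷ w′ ∷ []) (z ∷ w ∷ [])
      ((z≢w ∷ []) ∷ singleton)
      (λ { (here refl) → there (there (here refl)) ; (there (here refl)) → there (there (there (here refl))) })
      (λ { (here refl) → z∈ ; (there (here refl)) → w∈ })
      (z , here refl) ≤-refl
      (λ { (here refl) (here refl) → irrefl z∈
         ; (here refl) (there (here refl)) → zw
         ; (there (here refl)) (here refl) → zw ∘ symm w∈ z∈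
         ; (there (here refl)) (there (here refl)) → irrefl w∈ })
      (λ { (here refl) p∈ p∈N → case z-only p∈N of λ where
             (here refl) → proj₂ (∈-∖⁻ p∈) (here refl)
             (there (here refl)) → proj₂ (∈-∖⁻ p∈) (there (here refl))
             (there (there (here refl))) → proj₂ (∈-∖⁻ p∈) (there (there (there (there (here refl)))))
         ; (there (here refl)) p∈ p∈N → case w-only p∈N of λ where
             (here refl) → proj₂ (∈-∖⁻ p∈) (here refl)
             (there (here refl)) → proj₂ (∈-∖⁻ p∈) (there (here refl))
             (there (there (here refl))) → proj₂ (∈-∖⁻ p∈) (there (there (there (there (there (here refl)))))) })
      where
      open Triangle T
      w∈ : w ∈ A
      w∈ = proj₁ (∈-∖⁻ w∈′)
      z≢w : z ≢ w
      z≢w refl = proj₂ (∈-∖⁻ w∈′) (there (there (here refl)))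
      zw : w ∉ N z
      zw zw = K4-free record
        { p∈ = x∈ ; q∈ = y∈ ; r∈ = z∈ ; s∈ = w∈ ; pq = xy ; pr = xz ; ps = xw ; qr = yz ; qs = yw ; rs = zw }

    -- The edge `x′y′` keeps a solution of the rest from containing both `x′` and `y′`, so at least
    -- one of `x` and `y` can be added to it.
    module Contract {x y z x′ y′} (T : Triangle x y z)
      (nx : Third-neighbour x y z x′) (ny : Third-neighbour y x z y′)
      (x′∈ : x′ ∈ A ∖ (x ∷ y ∷ z ∷ [])) (y′∈ : y′ ∈ A ∖ (x ∷ y ∷ z ∷ [])) (x′≢y′ : x′ ≢ y′) where

      open Triangle T
      open Link N x y x′ y′ public

      S A′ : List V
      S = x ∷ y ∷ z ∷ []
      A′ = A ∖ S

      kept : ∀ {s p} → p ∈ A′ → p ∈ N s → p ∈ linked s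
      kept p∈ p∈N = linked-old p∈N (∉⇒≢ (proj₂ (∈-∖⁻ p∈)) (here refl))
        (∉⇒≢ (proj₂ (∈-∖⁻ p∈)) (there (here refl)))

      linked-symm : SymmetricOn A′ (λ s p → p ∈ linked s)
      linked-symm s∈ p∈ sp with linked-split sp
      ... | inj₁ old = kept s∈ (symm (proj₁ (∈-∖⁻ s∈)) (proj₁ (∈-∖⁻ p∈)) old)
      ... | inj₂ (inj₁ (refl , refl)) = linked-new₂ x′≢y′ (symm y∈ (proj₁ (∈-∖⁻ y′∈)) (proj₁ ny))
      ... | inj₂ (inj₂ (refl , refl)) = linked-new₁ (symm x∈ (proj₁ (∈-∖⁻ x′∈)) (proj₁ nx))

      linked-irrefl : ∀ {s} → s ∈ A′ → s ∉ linked s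
      linked-irrefl s∈ ss with linked-split ss
      ... | inj₁ old = irrefl (proj₁ (∈-∖⁻ s∈)) old
      ... | inj₂ (inj₁ (refl , e)) = x′≢y′ e
      ... | inj₂ (inj₂ (refl , e)) = x′≢y′ (sym e)

      Bad : V → V → V → V → Set
      Bad = K4 A′ (λ s p → p ∈ linked s)

      bad-at-link : ∀ {p q r s} → Bad p q r s → ∃ λ u → ∃ λ v → Bad x′ y′ u v
      bad-at-link Q with new-edge-first (proj₁ ∘ ∈-∖⁻) K4-free linked-symm (λ _ _ → linked-split) Q
      ... | _ , _ , _ , _ , Q′ , inj₁ (refl , refl) = _ , _ , Q′
      ... | _ , _ , _ , _ , Q′ , inj₂ (refl , refl) = _ , _ , K4-swap₁₂ linked-symm Q′

      contract : (∀ {u v} → ¬ Bad x′ y′ u v) → Third A (Independent N)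
      contract good = extend-third S unique
        (IH A′ linked (∖-shrinks x∈ (here refl)) (∖-unique unique) G′) extend
        where
        G′ : Subcubic A′ linked
        G′ = record
          { degree≤3 = λ s → ≤-trans (≤-reflexive (length-map (redirect s) (N s))) (degree≤3 s)
          ; symm = linked-symm
          ; irrefl = linked-irrefl
          ; K4-free = λ Q → let _ , _ , Q′ = bad-at-link Q in good Q′
          }

        add : ∀ {a} X → X ⊆ A′ → Independent linked X → a ∈ A → a ∈ S → (∀ {p} → p ∈ X → p ∉ N a) →
          ∃ λ Y → Unique Y × Y ⊆ S × Y ⊆ A × 3 ≤ 3 * length Y × Independent N (Y ++ X)
        add {a} X X⊆ indX a∈ a∈S free = a ∷ [] , singleton , (λ { (here refl) → a∈S }) ,
          (λ { (here refl) → a∈ }) , ≤-refl , λ where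
            (here refl) (here refl) → irrefl a∈
            (here refl) (there p∈) → free p∈
            (there p∈) (here refl) → free p∈ ∘ symm (proj₁ (∈-∖⁻ (X⊆ p∈))) a∈
            (there p∈) (there q∈) → indX p∈ q∈ ∘ kept (X⊆ q∈)

        extend : ∀ X → X ⊆ A′ → Independent linked X →
          ∃ λ Y → Unique Y × Y ⊆ S × Y ⊆ A × 3 ≤ 3 * length Y × Independent N (Y ++ X)
        extend X X⊆ indX with x′ ∈? X
        ... | no x′∉ = add X X⊆ indX x∈ (here refl) λ p∈ p∈N → case proj₂ nx p∈N of λ where
          (here refl) → proj₂ (∈-∖⁻ (X⊆ p∈)) (there (here refl))
          (there (here refl)) → proj₂ (∈-∖⁻ (X⊆ p∈)) (there (there (here refl)))
          (there (there (here refl))) → x′∉ p∈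
        ... | yes x′∈X = add X X⊆ indX y∈ (there (here refl)) λ p∈ p∈N → case proj₂ ny p∈N of λ where
          (here refl) → proj₂ (∈-∖⁻ (X⊆ p∈)) (here refl)
          (there (here refl)) → proj₂ (∈-∖⁻ (X⊆ p∈)) (there (there (here refl)))
          (there (there (here refl))) →
            indX x′∈X p∈ (linked-new₁ (symm x∈ (proj₁ (∈-∖⁻ x′∈)) (proj₁ nx)))

    private
      swap-last : ∀ {x y z : V} → x ∷ y ∷ z ∷ [] ⊆ x ∷ z ∷ y ∷ []
      swap-last (here e) = here e
      swap-last (there (here e)) = there (there (here e))
      swap-last (there (there (here e))) = there (here e)

      swap-first : ∀ {x y z : V} → x ∷ y ∷ z ∷ [] ⊆ y ∷ x ∷ z ∷ []
      swap-first (here e) = there (here e)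
      swap-first (there (here e)) = here e
      swap-first (there (there e)) = there (there e)

      ∖-antitone : ∀ {S S′ : List V} → S ⊆ S′ → A ∖ S′ ⊆ A ∖ S
      ∖-antitone sub p∈ = ∈-∖⁺ (proj₁ (∈-∖⁻ p∈)) (proj₂ (∈-∖⁻ p∈) ∘ sub)

    -- If x′y′ closes up to a K4 on x′, y′, u, v, then N x′ = {x, u, v}; a K4 closed by x′z′ would
    -- also contain u and v, making u adjacent to x′, y′, z′ and v.
    one-link-good : ∀ {x y z x′ y′ z′} (T : Triangle x y z)
      (nx : Third-neighbour x y z x′) (ny : Third-neighbour y x z y′) (nz : Third-neighbour z x y z′)
      (x′∈ : x′ ∈ A ∖ (x ∷ y ∷ z ∷ [])) (y′∈ : y′ ∈ A ∖ (x ∷ y ∷ z ∷ [])) (z′∈ : z′ ∈ A ∖ (x ∷ z ∷ y ∷ [])) →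
      (x′∈₂ : x′ ∈ A ∖ (x ∷ z ∷ y ∷ [])) →
      (x′≢y′ : x′ ≢ y′) (x′≢z′ : x′ ≢ z′) → y′ ≢ z′ →
      ∀ {u v u₂ v₂} → Contract.Bad T nx ny x′∈ y′∈ x′≢y′ x′ y′ u v →
      Contract.Bad (reflect T) (proj₁ nx , swap-first ∘ proj₂ nx) nz x′∈₂ z′∈ x′≢z′ x′ z′ u₂ v₂ → ⊥
    one-link-good {x} {y} {z} {x′} {y′} {z′} T nx ny nz x′∈ y′∈ z′∈ x′∈₂ x′≢y′ x′≢z′ y′≢z′ {u} {v} {u₂} {v₂} Q Q₂ =
      contradictory
      where
      module T = Triangle T
      module C₁ = Contract T nx ny x′∈ y′∈ x′≢y′
      module C₂ = Contract (reflect T) (proj₁ nx , swap-first ∘ proj₂ nx) nz x′∈₂ z′∈ x′≢z′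
      module Q = K4 Q
      module Q₂ = K4 Q₂

      loop₁ : ∀ {s p} → s ∈ C₁.A′ → p ∈ C₁.linked s → s ≢ p
      loop₁ s∈ sp refl = C₁.linked-irrefl s∈ sp
      loop₂ : ∀ {s p} → s ∈ C₂.A′ → p ∈ C₂.linked s → s ≢ p
      loop₂ s∈ sp refl = C₂.linked-irrefl s∈ sp

      old₁ : ∀ {s p} → p ≢ x′ → p ≢ y′ → p ∈ C₁.linked s → p ∈ N s
      old₁ px py sp with C₁.linked-split sp
      ... | inj₁ old = old
      ... | inj₂ (inj₁ (_ , e)) = ⊥-elim (py e)
      ... | inj₂ (inj₂ (_ , e)) = ⊥-elim (px e)
      old₂ : ∀ {s p} → p ≢ x′ → p ≢ z′ → p ∈ C₂.linked s → p ∈ N s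
      old₂ px pz sp with C₂.linked-split sp
      ... | inj₁ old = old
      ... | inj₂ (inj₁ (_ , e)) = ⊥-elim (pz e)
      ... | inj₂ (inj₂ (_ , e)) = ⊥-elim (px e)

      x′≢u : x′ ≢ u
      x′≢u = loop₁ Q.p∈ Q.pr
      x′≢v : x′ ≢ v
      x′≢v = loop₁ Q.p∈ Q.ps
      y′≢u : y′ ≢ u
      y′≢u = loop₁ Q.q∈ Q.qr
      y′≢v : y′ ≢ v
      y′≢v = loop₁ Q.q∈ Q.qs
      u≢v : u ≢ v
      u≢v = loop₁ Q.r∈ Q.rs
      z′≢u₂ : z′ ≢ u₂
      z′≢u₂ = loop₂ Q₂.q∈ Q₂.qr
      z′≢v₂ : z′ ≢ v₂
      z′≢v₂ = loop₂ Q₂.q∈ Q₂.qs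
      u₂≢v₂ : u₂ ≢ v₂
      u₂≢v₂ = loop₂ Q₂.r∈ Q₂.rs

      alive₁ : ∀ {p} → p ∈ C₁.A′ → p ∈ A
      alive₁ = proj₁ ∘ ∈-∖⁻
      alive₂ : ∀ {p} → p ∈ C₂.A′ → p ∈ A
      alive₂ = proj₁ ∘ ∈-∖⁻

      u∈N : u ∈ N x′
      u∈N = old₁ (≢-sym x′≢u) (≢-sym y′≢u) Q.pr
      v∈N : v ∈ N x′
      v∈N = old₁ (≢-sym x′≢v) (≢-sym y′≢v) Q.ps
      u₂∈N : u₂ ∈ N x′
      u₂∈N = old₂ (≢-sym (loop₂ Q₂.p∈ Q₂.pr)) (≢-sym z′≢u₂) Q₂.pr
      v₂∈N : v₂ ∈ N x′
      v₂∈N = old₂ (≢-sym (loop₂ Q₂.p∈ Q₂.ps)) (≢-sym z′≢v₂) Q₂.ps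

      x′-only : N x′ ⊆ x ∷ u ∷ v ∷ []
      x′-only = only-three (degree≤3 x′) (symm T.x∈ (alive₁ x′∈) (proj₁ nx)) u∈N v∈N
        (≢-sym (∉⇒≢ (proj₂ (∈-∖⁻ Q.r∈)) (here refl))) (≢-sym (∉⇒≢ (proj₂ (∈-∖⁻ Q.s∈)) (here refl))) u≢v

      u-or-v : ∀ {p} → p ∈ C₂.A′ → p ∈ N x′ → p ≡ u ⊎ p ≡ v
      u-or-v p∈ p∈N with x′-only p∈N
      ... | here refl = ⊥-elim (proj₂ (∈-∖⁻ p∈) (here refl))
      ... | there (here e) = inj₁ e
      ... | there (there (here e)) = inj₂ e

      crowded : ∀ {a b} → x′ ∈ N a → y′ ∈ N a → b ∈ N a → z′ ∈ N a → x′ ≢ b → y′ ≢ b → b ≢ z′ → ⊥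
      crowded {a} xa ya ba za xb yb bz = no-four (degree≤3 a) xa ya ba za x′≢y′ xb x′≢z′ yb y′≢z′ bz

      back : ∀ {s p} → s ∈ C₁.A′ → p ∈ C₁.A′ → p ≢ x′ → p ≢ y′ → p ∈ C₁.linked s → s ∈ N p
      back s∈ p∈ px py sp = symm (alive₁ s∈) (alive₁ p∈) (old₁ px py sp)

      back₂ : ∀ {s p} → s ∈ C₂.A′ → p ∈ C₂.A′ → p ≢ x′ → p ≢ z′ → p ∈ C₂.linked s → s ∈ N p
      back₂ s∈ p∈ px pz sp = symm (alive₂ s∈) (alive₂ p∈) (old₂ px pz sp)

      z′∈u₂ : z′ ∈ N u₂
      z′∈u₂ = back₂ Q₂.q∈ Q₂.r∈ (≢-sym (loop₂ Q₂.p∈ Q₂.pr)) (≢-sym z′≢u₂) Q₂.qr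

      contradictory : ⊥
      contradictory with u-or-v Q₂.r∈ u₂∈N | u-or-v Q₂.s∈ v₂∈N
      ... | inj₁ refl | inj₁ refl = u₂≢v₂ refl
      ... | inj₂ refl | inj₂ refl = u₂≢v₂ refl
      ... | inj₁ refl | inj₂ refl = crowded
        (symm (alive₁ Q.p∈) (alive₁ Q.r∈) u∈N) (back Q.q∈ Q.r∈ (≢-sym x′≢u) (≢-sym y′≢u) Q.qr)
        (old₁ (≢-sym x′≢v) (≢-sym y′≢v) Q.rs) z′∈u₂ x′≢v y′≢v (≢-sym z′≢v₂)
      ... | inj₂ refl | inj₁ refl = crowded
        (symm (alive₁ Q.p∈) (alive₁ Q.s∈) v∈N) (back Q.q∈ Q.s∈ (≢-sym x′≢v) (≢-sym y′≢v) Q.qs)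
        (back Q.r∈ Q.s∈ (≢-sym x′≢v) (≢-sym y′≢v) Q.rs) z′∈u₂ x′≢u y′≢u (≢-sym z′≢v₂)

    triangle-step : ∀ {x y z} → Triangle x y z → Third A (Independent N)
    triangle-step {x} {y} {z} T
      -- The triangle is read from each corner: as `x, y, z`, as `y, x, z` and as `z, x, y`.
      with x′ , nx ← third-neighbour T
         | y′ , ny ← third-neighbour (rotate (rotate (reflect T)))
         | z′ , nz ← third-neighbour (rotate (rotate T))
      with x′ ∈? (A ∖ (x ∷ y ∷ z ∷ [])) | y′ ∈? (A ∖ (y ∷ x ∷ z ∷ [])) | z′ ∈? (A ∖ (z ∷ x ∷ y ∷ []))
    ... | no x′∉ | _ | _ = dangling-triangle T nx x′∉
    ... | yes _ | no y′∉ | _ = dangling-triangle (rotate (rotate (reflect T))) ny y′∉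
    ... | yes _ | yes _ | no z′∉ = dangling-triangle (rotate (rotate T)) nz z′∉
    ... | yes x′∈ | yes y′∈ | yes z′∈ with x′ ≟ y′ | x′ ≟ z′ | y′ ≟ z′
    ... | yes refl | _ | _ = diamond T nz x′∈ (proj₁ nx) (proj₁ ny)
    ... | no _ | yes refl | _ = diamond (reflect T) ny (∖-antitone swap-last x′∈) (proj₁ nx) (proj₁ nz)
    ... | no _ | no _ | yes refl =
      diamond (rotate T) nx (∖-antitone swap-last y′∈) (proj₁ ny) (proj₁ nz)
    ... | no x′≢y′ | no x′≢z′ | no y′≢z′
      with has-K4? {A = A ∖ (x ∷ y ∷ z ∷ [])} {R = λ s p → p ∈ Link.linked N x y x′ y′ s}
             (λ s p → p ∈? Link.linked N x y x′ y′ s)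
    ... | no none = Contract.contract T nx ny x′∈ (∖-antitone swap-first y′∈) x′≢y′
                      (λ Q → none (_ , _ , _ , _ , Q))
    -- The link `x′y′` closes a K4, so by `one-link-good` the link `x′z′` does not, and that one is
    -- added instead.
    ... | yes (_ , _ , _ , _ , Q) =
      let _ , _ , Q′ = Contract.bad-at-link T nx ny x′∈ y′∈₁ x′≢y′ Q in
      Contract.contract (reflect T) (proj₁ nx , swap-first ∘ proj₂ nx) nz x′∈₂ z′∈₂ x′≢z′
        (one-link-good T nx ny nz x′∈ y′∈₁ z′∈₂ x′∈₂ x′≢y′ x′≢z′ y′≢z′ Q′)
      where
      y′∈₁ = ∖-antitone swap-first y′∈
      z′∈₂ = ∖-antitone swap-first z′∈
      x′∈₂ = ∖-antitone swap-last x′∈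

  -- Local search in the triangle-free case.

  module _ {A : List V} {N : V → List V} (unique : Unique A) (G : Subcubic A N)
    (triangle-free : ∀ {x y z} → x ∈ A → y ∈ A → z ∈ A → y ∈ N x → z ∈ N x → z ∉ N y) where
    open Subcubic G

    record IndependentSet : Set where
      constructor independentSet
      field
        members : List V
        distinct : Unique members
        within : members ⊆ A
        independent : Independent N members
    open IndependentSet

    Addable : List V → V → Set
    Addable X u = u ∉ X × All (_∉ N u) X

    -- The vertices that `x` alone keeps from being addable.
    Private : List V → V → V → Set
    Private X x u = u ∈ A × u ∉ X × u ∈ N x × All (λ z → z ∈ N u → z ≡ x) X

    private? : ∀ X x u → Dec (Private X x u)
    private? X x u = (u ∈? A) ×-dec ¬? (u ∈? X) ×-dec (u ∈? N x) ×-dec all? (λ z → (z ∈? N u) →-dec (z ≟ x)) X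

    module _ (I : IndependentSet) where
      private
        X = members I

      add-vertex : ∀ {u} → u ∈ A → Addable X u → ∃ λ J → length X < length (members J)
      add-vertex {u} u∈ (u∉ , apart) = independentSet (u ∷ X) (¬Any⇒All¬ X u∉ ∷ distinct I)
        (λ { (here refl) → u∈ ; (there p∈) → within I p∈ })
        (λ { (here refl) (here refl) → irrefl u∈
           ; (here refl) (there q∈) → All.lookup apart q∈
           ; (there p∈) (here refl) → All.lookup apart p∈ ∘ symm (within I p∈) u∈
           ; (there p∈) (there q∈) → independent I p∈ q∈ }) , ≤-refl

      -- Triangle-freeness enters here: the neighbours `u` and `w` of `x` are non-adjacent, and `x`
      -- is their only conflict with `X`, so trading `x` for both gains a vertex.
      swap-vertex : ∀ {x u w} → x ∈ X → u ≢ w → Private X x u → Private X x w →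
                    ∃ λ J → length X < length (members J)
      swap-vertex {x} {u} {w} x∈ u≢w (u∈ , u∉ , xu , onlyᵤ) (w∈ , w∉ , xw , onlyw) =
        independentSet (u ∷ w ∷ X ∖ (x ∷ []))
          ((u≢w ∷ ¬Any⇒All¬ _ (u∉ ∘ proj₁ ∘ ∈-∖⁻)) ∷ ¬Any⇒All¬ _ (w∉ ∘ proj₁ ∘ ∈-∖⁻) ∷ ∖-unique (distinct I))
          sub ind , s≤s (length-∖ {ys = x ∷ []} (distinct I))
        where
        sub : u ∷ w ∷ X ∖ (x ∷ []) ⊆ A
        sub (here refl) = u∈
        sub (there (here refl)) = w∈
        sub (there (there p∈)) = within I (proj₁ (∈-∖⁻ p∈))
        apart : ∀ {v p} → All (λ z → z ∈ N v → z ≡ x) X → p ∈ X ∖ (x ∷ []) → p ∉ N v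
        apart only p∈ vp = proj₂ (∈-∖⁻ p∈) (here (All.lookup only (proj₁ (∈-∖⁻ p∈)) vp))
        ind : Independent N (u ∷ w ∷ X ∖ (x ∷ []))
        ind (here refl) (here refl) = irrefl u∈
        ind (here refl) (there (here refl)) = triangle-free (within I x∈) u∈ w∈ xu xw
        ind (here refl) (there (there q∈)) = apart onlyᵤ q∈
        ind (there (here refl)) (here refl) = triangle-free (within I x∈) w∈ u∈ xw xu
        ind (there (here refl)) (there (here refl)) = irrefl w∈
        ind (there (here refl)) (there (there q∈)) = apart onlyw q∈
        ind (there (there p∈)) (here refl) = apart onlyᵤ p∈ ∘ symm (sub (there (there p∈))) u∈
        ind (there (there p∈)) (there (here refl)) = apart onlyw p∈ ∘ symm (sub (there (there p∈))) w∈
        ind (there (there p∈)) (there (there q∈)) = independent I (proj₁ (∈-∖⁻ p∈)) (proj₁ (∈-∖⁻ q∈))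

      -- Each x ∈ X sends a token to its at most three neighbours, and one more to its private
      -- neighbour; every vertex outside X then receives two tokens.
      module Tokens (no-add : ∀ {u} → u ∈ A → ¬ Addable X u)
        (no-swap : ∀ {x u w} → x ∈ X → Private X x u → Private X x w → u ≡ w) where

        -- Receiver and sender, with `nothing` as sender of the extra token for a private neighbour.
        -- The two tokens of a vertex are then different pairs, so that list lengths can be
        -- compared.
        Token : Set
        Token = V × Maybe V

        private-token : V → List Token
        private-token x with Fin.any? (private? X x)
        ... | yes (u , _) = (u , nothing) ∷ []
        ... | no _ = []

        private-token-length : ∀ x → length (private-token x) ≤ 1
        private-token-length x with Fin.any? (private? X x)
        ... | yes _ = ≤-refl
        ... | no _ = z≤n

        private-token-∈ : ∀ {x u} → x ∈ X → Private X x u → (u , nothing) ∈ private-token x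
        private-token-∈ {x} x∈ priv with Fin.any? (private? X x)
        ... | yes (w , priv′) = here (cong (_, nothing) (no-swap x∈ priv priv′))
        ... | no none = ⊥-elim (none (_ , priv))

        sent : V → List Token
        sent x = map (_, just x) (N x) ++ private-token x

        sent-length : ∀ x → length (sent x) ≤ 4
        sent-length x = begin
          length (sent x) ≡⟨ length-++ (map (_, just x) (N x)) ⟩
          length (map (_, just x) (N x)) + length (private-token x)
            ≤⟨ +-mono-≤ (≤-trans (≤-reflexive (length-map _ (N x))) (degree≤3 x)) (private-token-length x) ⟩
          4 ∎
          where open ≤-Reasoning

        all-sent-length : ∀ Y → length (concatMap sent Y) ≤ 4 * length Y
        all-sent-length [] = z≤n
        all-sent-length (x ∷ Y) = begin
          length (sent x ++ concatMap sent Y) ≡⟨ length-++ (sent x) ⟩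
          length (sent x) + length (concatMap sent Y) ≤⟨ +-mono-≤ (sent-length x) (all-sent-length Y) ⟩
          4 + 4 * length Y ≡⟨ *-suc 4 (length Y) ⟨
          4 * suc (length Y) ∎
          where open ≤-Reasoning

        tokens : List Token
        tokens = concatMap sent X

        outside : List V
        outside = A ∖ X

        TwoTokens : V → Set
        TwoTokens u = ∃ λ s → ∃ λ t → s ≢ t × (u , s) ∈ tokens × (u , t) ∈ tokens

        is-sent : ∀ {x t} → x ∈ X → t ∈ sent x → t ∈ tokens
        is-sent x∈ t∈ = ∈-concatMap⁺ sent (lose x∈ t∈)

        neighbour-token : ∀ {x u} → x ∈ X → u ∈ A → x ∈ N u → (u , just x) ∈ tokens
        neighbour-token x∈ u∈ ux = is-sent x∈ (∈-++⁺ˡ (∈-map⁺ _ (symm u∈ (within I x∈) ux)))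

        two-tokens : ∀ {u} → u ∈ outside → TwoTokens u
        two-tokens {u} u∈′ with ∈-∖⁻ u∈′
        ... | u∈ , u∉ with any? (_∈? N u) X
        ... | no none = ⊥-elim (no-add u∈ (u∉ , ¬Any⇒All¬ X none))
        ... | yes some with find some
        ... | x , x∈ , ux with any? (λ z → (z ∈? N u) ×-dec ¬? (z ≟ x)) X
        ... | yes others = let z , z∈ , uz , z≢x = find others in
          just x , just z , (z≢x ∘ sym ∘ just-injective) , neighbour-token x∈ u∈ ux , neighbour-token z∈ u∈ uz
        -- A vertex whose only neighbour in `X` is `x` is private to `x`, so its second token is the
        -- extra one.
        ... | no none = just x , nothing , (λ ()) , neighbour-token x∈ u∈ ux ,
          is-sent x∈ (∈-++⁺ʳ (map _ (N x)) (private-token-∈ x∈ (u∈ , u∉ , symm u∈ (within I x∈) ux , All.tabulate only)))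
          where
          only : ∀ {z} → z ∈ X → z ∈ N u → z ≡ x
          only {z} z∈ uz = decidable-stable (z ≟ x) (λ z≢x → none (lose z∈ (uz , z≢x)))

        first second : V → Maybe V
        first u with u ∈? outside
        ... | yes u∈ = proj₁ (two-tokens u∈)
        ... | no _ = nothing
        second u with u ∈? outside
        ... | yes u∈ = proj₁ (proj₂ (two-tokens u∈))
        ... | no _ = nothing

        received : ∀ {u} → u ∈ outside → first u ≢ second u × (u , first u) ∈ tokens × (u , second u) ∈ tokens
        received {u} u∈ with u ∈? outside
        ... | yes u∈′ = proj₂ (proj₂ (two-tokens u∈′))
        ... | no u∉ = ⊥-elim (u∉ u∈)

        all-received : List Token
        all-received = map (λ u → u , first u) outside ++ map (λ u → u , second u) outside

        all-received-unique : Unique all-received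
        all-received-unique = Unique.++⁺ (Unique.map⁺ (cong proj₁) uo) (Unique.map⁺ (cong proj₁) uo) disjoint
          where
          uo = ∖-unique unique
          disjoint : ∀ {t} → ¬ (t ∈ map (λ u → u , first u) outside × t ∈ map (λ u → u , second u) outside)
          disjoint (t∈₁ , t∈₂) with ∈-map⁻ _ t∈₁
          ... | u , u∈ , refl with ∈-map⁻ _ t∈₂
          ... | _ , _ , e with refl ← cong proj₁ e = proj₁ (received u∈) (cong proj₂ e)

        all-received-⊆ : all-received ⊆ tokens
        all-received-⊆ t∈ with ∈-++⁻ (map (λ u → u , first u) outside) t∈
        ... | inj₁ t∈₁ with ∈-map⁻ _ t∈₁
        ... | u , u∈ , refl = proj₁ (proj₂ (received u∈))
        all-received-⊆ t∈ | inj₂ t∈₂ with ∈-map⁻ _ t∈₂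
        ... | u , u∈ , refl = proj₂ (proj₂ (received u∈))

        large-enough : length A ≤ 3 * length X
        large-enough = begin
          length A ≤⟨ length-∖ unique ⟩
          length X + length outside ≤⟨ +-monoʳ-≤ (length X) (*-cancelˡ-≤ 2 doubled) ⟩
          length X + 2 * length X ∎
          where
          open ≤-Reasoning
          -- Two tokens arrive at each outside vertex and each member of `X` sends at most four.
          doubled : 2 * length outside ≤ 2 * (2 * length X)
          doubled = begin
            2 * length outside ≡⟨ cong (length outside +_) (+-identityʳ (length outside)) ⟩
            length outside + length outside ≡⟨ cong₂ _+_ (length-map _ outside) (length-map _ outside) ⟨
            length (map (λ u → u , first u) outside) + length (map (λ u → u , second u) outside)
              ≡⟨ length-++ (map (λ u → u , first u) outside) ⟨
            length all-received ≤⟨ unique-⊆⇒length≤ all-received-unique all-received-⊆ ⟩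
            length tokens ≤⟨ all-sent-length X ⟩
            4 * length X ≡⟨ *-assoc 2 2 (length X) ⟩
            2 * (2 * length X) ∎

      improve : length A ≤ 3 * length X ⊎ ∃ λ J → length X < length (members J)
      improve with any? (λ u → ¬? (u ∈? X) ×-dec all? (λ x → ¬? (x ∈? N u)) X) A
      ... | yes some = let u , u∈ , addable = find some in inj₂ (add-vertex u∈ addable)
      ... | no none with any? (λ x → Fin.any? λ u → Fin.any? λ w →
                          ¬? (u ≟ w) ×-dec private? X x u ×-dec private? X x w) X
      ... | yes some = let x , x∈ , u , w , u≢w , pu , pw = find some in inj₂ (swap-vertex x∈ u≢w pu pw)
      ... | no none₂ = inj₁ (Tokens.large-enough (λ u∈ addable → none (lose u∈ addable))
        (λ {x} {u} {w} x∈ pu pw → decidable-stable (u ≟ w) λ u≢w → none₂ (lose x∈ (u , w , u≢w , pu , pw))))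

    -- The size reached is the counter: with `k` equal to `length A`, the second outcome is a set so
    -- large that the bound holds trivially.
    local-search : ∀ k → Third A (Independent N) ⊎ ∃ λ I → k ≤ length (members I)
    local-search zero = inj₂ (independentSet [] [] (λ ()) (λ ()) , z≤n)
    local-search (suc k) with local-search k
    ... | inj₁ done = inj₁ done
    ... | inj₂ (I , k≤) with improve I
    ... | inj₁ large = inj₁ (third (members I) (distinct I) (within I) (independent I) large)
    ... | inj₂ (J , I<J) = inj₂ (J , ≤-trans (s≤s k≤) I<J)

    triangle-free-third : Third A (Independent N)
    triangle-free-third with local-search (length A)
    ... | inj₁ done = done
    ... | inj₂ (I , large) =
      third (members I) (distinct I) (within I) (independent I) (≤-trans large (m≤m+n _ _))

  independent-third : ∀ k A N → length A < k → Unique A → Subcubic A N → Third A (Independent N)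
  independent-third (suc k) A N (s≤s A≤k) unique G
    with any? (λ x → any? (λ y → any? (λ z → (y ∈? N x) ×-dec (z ∈? N x) ×-dec (z ∈? N y)) A) A) A
  ... | no none = triangle-free-third unique G
    λ x∈ y∈ z∈ xy xz yz → none (lose x∈ (lose y∈ (lose z∈ (xy , xz , yz))))
  ... | yes some =
    let x , x∈ , some₁ = find some ; y , y∈ , some₂ = find some₁ ; z , z∈ , xy , xz , yz = find some₂ in
    triangle-step unique G (λ A′ N′ A′<A → independent-third k A′ N′ (<-≤-trans A′<A A≤k))
      record { x∈ = x∈ ; y∈ = y∈ ; z∈ = z∈ ; xy = xy ; xz = xz ; yz = yz }

-- Two types of edges

_≟ᵗ_ : DecidableEquality EType
c ≟ᵗ c = yes refl
c ≟ᵗ d = no (λ ())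
d ≟ᵗ c = no (λ ())
d ≟ᵗ d = yes refl

module _ {m : ℕ} where

  private
    V : Set
    V = Fin m

    Port : Set
    Port = EType × V

    _≟ᵖ_ : DecidableEquality Port
    _≟ᵖ_ = ≡-dec _≟ᵗ_ _≟_

  open DecMembership (_≟_ {m}) using (_∈?_)
  open DecMembership _≟ᵖ_ using () renaming (_∈?_ to _∈ᵖ?_)
  open ShortLists (_≟_ {m}) using (_∖_; ∈-∖⁺; ∈-∖⁻; ∖-unique; ∖-shrinks; Third; third; extend-third; only-three)
  module Ports = ShortLists _≟ᵖ_

  -- adj x lists the edges at x, each as its type and its other end, parallel edges repeatedly.
  Ports-of : Set
  Ports-of = V → List Port

  C D : Ports-of → V → V → Set
  C adj x y = (c , y) ∈ adj x
  D adj x y = (d , y) ∈ adj x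

  -- `degree≤3` counts ports, so a c-edge and a parallel d-edge use up two of the three;
  -- `choose-independent` relies on this.
  record Mixed (A : List V) (adj : Ports-of) : Set where
    field
      degree≤3 : ∀ x → length (adj x) ≤ 3
      symm : ∀ {t x y} → x ∈ A → y ∈ A → (t , y) ∈ adj x → (t , x) ∈ adj y
      irrefl : ∀ {t x} → x ∈ A → (t , x) ∉ adj x
      K4-free : K4Free A (C adj)

  Near : Ports-of → V → V → Set
  Near adj w x = x ≡ w ⊎ D adj w x

  -- `d-free` expresses the bound two on closed d-neighbourhoods without cardinalities.
  record Limited (A : List V) (adj : Ports-of) (X : List V) : Set where
    constructor limited
    field
      c-free : ∀ {x y} → x ∈ X → y ∈ X → ¬ C adj x y
      d-free : ∀ {w x y z} → w ∈ A → x ∈ X → y ∈ X → z ∈ X → x ≢ y → x ≢ z → y ≢ z →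
               Near adj w x → Near adj w y → ¬ Near adj w z

  port-≢ : ∀ {t t′ : EType} {x y : V} → x ≢ y → (t , x) ≢ (t′ , y)
  port-≢ x≢y refl = x≢y refl

  no-three-in-two : ∀ {p q x y z : V} → x ∈ p ∷ q ∷ [] → y ∈ p ∷ q ∷ [] → z ∈ p ∷ q ∷ [] →
                    x ≢ y → x ≢ z → y ≢ z → ⊥
  no-three-in-two (here refl) (here refl) _ xy _ _ = xy refl
  no-three-in-two (here refl) (there (here refl)) (here refl) _ xz _ = xz refl
  no-three-in-two (here refl) (there (here refl)) (there (here refl)) _ _ yz = yz refl
  no-three-in-two (there (here refl)) (here refl) (here refl) _ _ yz = yz refl
  no-three-in-two (there (here refl)) (here refl) (there (here refl)) _ xz _ = xz refl
  no-three-in-two (there (here refl)) (there (here refl)) _ xy _ _ = xy refl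

  -- Three distinct elements exhaust a list of three, so it does not matter in which order they were
  -- given.
  all-three : {P : V → Set} → ∀ {p q r x y z} → x ∈ p ∷ q ∷ r ∷ [] → y ∈ p ∷ q ∷ r ∷ [] → z ∈ p ∷ q ∷ r ∷ [] →
              x ≢ y → x ≢ z → y ≢ z → P x → P y → P z → P p × P q × P r
  all-three {P} {x = x} {y} {z} x∈ y∈ z∈ xy xz yz px py pz =
    hit (here refl) , hit (there (here refl)) , hit (there (there (here refl)))
    where
    hit : ∀ {w} → w ∈ _ → P w
    hit w∈ with only-three ≤-refl x∈ y∈ z∈ xy xz yz w∈
    ... | here refl = px
    ... | there (here refl) = py
    ... | there (there (here refl)) = pz

  Mixed-⊆ : ∀ {A A′ adj} → A′ ⊆ A → Mixed A adj → Mixed A′ adj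
  Mixed-⊆ sub G = record
    { degree≤3 = degree≤3
    ; symm = λ x∈ y∈ → symm (sub x∈) (sub y∈)
    ; irrefl = irrefl ∘ sub
    ; K4-free = λ Q → let open K4 Q in K4-free record
        { p∈ = sub p∈ ; q∈ = sub q∈ ; r∈ = sub r∈ ; s∈ = sub s∈
        ; pq = pq ; pr = pr ; ps = ps ; qr = qr ; qs = qs ; rs = rs }
    }
    where open Mixed G

  MixedInduction : List V → Set
  MixedInduction A = ∀ A′ adj′ → length A′ < length A → Unique A′ → Mixed A′ adj′ → Third A′ (Limited A′ adj′)

  module _ {A : List V} {adj : Ports-of} (unique : Unique A) (G : Mixed A adj) where
    open Mixed G

    near? : ∀ w x → Dec (Near adj w x)
    near? w x = (x ≟ w) ⊎-dec ((d , x) ∈ᵖ? adj w)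

    private
      alive : ∀ {S x} → x ∈ A ∖ S → x ∈ A
      alive = proj₁ ∘ ∈-∖⁻

      dead-≢ : ∀ {S x y} → x ∈ A ∖ S → y ∈ S → x ≢ y
      dead-≢ x∈ y∈ refl = proj₂ (∈-∖⁻ x∈) y∈

    -- Deleting a set without adding edges.

    Interior : List V → V → Set
    Interior S w = ∀ {t z} → z ∈ A → (t , z) ∈ adj w → z ∈ S

    -- One of the at most three ports of the unchosen `w` leads to a vertex that is deleted and
    -- unchosen. Hence at most two chosen vertices are near `w`, whatever is chosen outside `S`.
    Spoiled : List V → List V → V → Set
    Spoiled S Y w = w ∉ Y × ∃ λ t → ∃ λ z → (t , z) ∈ adj w × z ∈ S × z ∉ Y

    -- Members of `Y` cannot be spoiled and are therefore interior, so `Y` has no edges to the rest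
    -- and a `w` outside `S` sees only the rest. An interior `w` in `S` sees only `Y`, and a spoiled
    -- one at most two chosen vertices.
    delete-set : MixedInduction A → (S Y : List V) → Unique Y → Y ⊆ S → Y ⊆ A → ∃ (_∈ Y) →
      length S ≤ 3 * length Y →
      (∀ {w} → w ∈ A → w ∈ S → Interior S w ⊎ Spoiled S Y w) →
      (∀ {x y} → x ∈ Y → y ∈ Y → ¬ C adj x y) →
      (∀ {w x y z} → w ∈ A → x ∈ Y → y ∈ Y → z ∈ Y → x ≢ y → x ≢ z → y ≢ z →
        Near adj w x → Near adj w y → ¬ Near adj w z) →
      Third A (Limited A adj)
    delete-set IH S Y uY Y⊆S Y⊆A (_ , y₀∈) len classify c-freeY d-freeY =
      extend-third S unique
        (IH _ adj (∖-shrinks (Y⊆A y₀∈) (Y⊆S y₀∈)) (∖-unique unique) (Mixed-⊆ alive G))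
        λ X X⊆ lim → Y , uY , Y⊆S , Y⊆A , len , extended X X⊆ lim
      where
      interiorY : ∀ {y} → y ∈ Y → Interior S y
      interiorY y∈ with classify (Y⊆A y∈) (Y⊆S y∈)
      ... | inj₁ int = int
      ... | inj₂ (y∉ , _) = ⊥-elim (y∉ y∈)

      module _ (X : List V) (X⊆ : X ⊆ A ∖ S) (lim : Limited (A ∖ S) adj X) where
        open Limited lim

        fresh : ∀ {x} → x ∈ X → x ∉ S
        fresh = proj₂ ∘ ∈-∖⁻ ∘ X⊆

        in-A : ∀ {x} → x ∈ Y ++ X → x ∈ A
        in-A x∈ with ∈-++⁻ Y x∈
        ... | inj₁ x∈Y = Y⊆A x∈Y
        ... | inj₂ x∈X = alive (X⊆ x∈X)

        from-X : ∀ {w x} → w ∈ A → w ∉ S → x ∈ Y ++ X → Near adj w x → x ∈ X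
        from-X w∈ w∉ x∈ near with ∈-++⁻ Y x∈ | near
        ... | inj₂ x∈X | _ = x∈X
        ... | inj₁ x∈Y | inj₁ refl = ⊥-elim (w∉ (Y⊆S x∈Y))
        ... | inj₁ x∈Y | inj₂ wx = ⊥-elim (w∉ (interiorY x∈Y w∈ (symm w∈ (Y⊆A x∈Y) wx)))

        from-Y : ∀ {w x} → w ∈ S → Interior S w → x ∈ Y ++ X → Near adj w x → x ∈ Y
        from-Y w∈ int x∈ near with ∈-++⁻ Y x∈ | near
        ... | inj₁ x∈Y | _ = x∈Y
        ... | inj₂ x∈X | inj₁ refl = ⊥-elim (fresh x∈X w∈)
        ... | inj₂ x∈X | inj₂ wx = ⊥-elim (fresh x∈X (int (alive (X⊆ x∈X)) wx))

        avoids : ∀ {x z} → x ∈ Y ++ X → z ∈ S → z ∉ Y → x ≢ z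
        avoids x∈ z∈ z∉ refl with ∈-++⁻ Y x∈
        ... | inj₁ x∈Y = z∉ x∈Y
        ... | inj₂ x∈X = fresh x∈X z∈

        beside : ∀ {w x} → w ∈ S → w ∉ Y → x ∈ Y ++ X → Near adj w x → D adj w x
        beside w∈ w∉ x∈ (inj₁ refl) = ⊥-elim (avoids x∈ w∈ w∉ refl)
        beside w∈ w∉ x∈ (inj₂ wx) = wx

        extended : Limited A adj (Y ++ X)
        extended .Limited.c-free x∈ y∈ xy with ∈-++⁻ Y x∈ | ∈-++⁻ Y y∈
        ... | inj₁ x∈Y | inj₁ y∈Y = c-freeY x∈Y y∈Y xy
        ... | inj₁ x∈Y | inj₂ y∈X = fresh y∈X (interiorY x∈Y (alive (X⊆ y∈X)) xy)
        ... | inj₂ x∈X | inj₁ y∈Y = fresh x∈X (interiorY y∈Y (alive (X⊆ x∈X)) (symm (in-A x∈) (in-A y∈) xy))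
        ... | inj₂ x∈X | inj₂ y∈X = c-free x∈X y∈X xy
        extended .Limited.d-free {w} w∈ x∈ y∈ z∈ xy xz yz nx ny nz with w ∈? S
        ... | no w∉ = d-free (∈-∖⁺ w∈ w∉) (from-X w∈ w∉ x∈ nx) (from-X w∈ w∉ y∈ ny) (from-X w∈ w∉ z∈ nz)
                        xy xz yz nx ny nz
        ... | yes w∈S with classify w∈ w∈S
        ... | inj₁ int = d-freeY w∈ (from-Y w∈S int x∈ nx) (from-Y w∈S int y∈ ny) (from-Y w∈S int z∈ nz)
                           xy xz yz nx ny nz
        ... | inj₂ (w∉Y , _ , u , wu , u∈ , u∉) =
          no-four (degree≤3 w) (beside w∈S w∉Y x∈ nx) (beside w∈S w∉Y y∈ ny) (beside w∈S w∉Y z∈ nz) wu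
            (port-≢ xy) (port-≢ xz) (port-≢ (avoids x∈ u∈ u∉))
            (port-≢ yz) (port-≢ (avoids y∈ u∈ u∉)) (port-≢ (avoids z∈ u∈ u∉))

    -- Choose both ends of a d-edge ve and delete their neighbourhood S. A deleted vertex p that is
    -- d-adjacent to a chosen vertex and to two survivors a, b forbids choosing both of these, which
    -- a new c-edge ab records.
    module ChooseEdge {v e : V} (v∈ : v ∈ A) (e∈ : e ∈ A) (ve : D adj v e) (¬ve : ¬ C adj v e) where

      ev : D adj e v
      ev = symm v∈ e∈ ve

      v≢e : v ≢ e
      v≢e refl = irrefl v∈ ve

      -- `Self` and `Companion` describe the vertex `s` deleted on behalf of a neighbour `q` of `e`.
      -- A common d-neighbour `q` of `v` and `e` is deleted anyway through `v`, so its place goes to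
      -- its remaining neighbour, which must not be chosen beside `v` and `e`. Otherwise `q` takes
      -- the place itself.
      Self : V → V → Set
      Self q s = s ≡ q ⊎ q ∈ A × D adj q v × ∃ λ t → (t , s) ∈ adj q

      Companion : V → V → Set
      Companion q s = (q ∈ A → D adj q v → D adj q e → ∀ {t p} → (t , p) ∈ adj q → p ∈ v ∷ e ∷ s ∷ []) × Self q s

      companion : ∀ q → ∃ (Companion q)
      companion q with (q ∈? A) ×-dec ((d , v) ∈ᵖ? adj q) ×-dec ((d , e) ∈ᵖ? adj q)
      ... | no ne = q , (λ q∈ qv qe → ⊥-elim (ne (q∈ , qv , qe))) , inj₁ refl
      ... | yes (q∈ , qv , qe) =
        let (t , s) , qs , only = Ports.third-element (degree≤3 q) qv qe (port-≢ v≢e) in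
        s , (λ _ _ _ qp → ∈-map⁺ proj₂ (only qp)) , inj₂ (q∈ , qv , t , qs)

      -- The six places are `v`, `e`, two for the other neighbours of `v` and two for those of `e`.
      -- By `anchored`, a deleted vertex has at most two ports to survivors.
      record Hull : Set where
        field
          S : List V
          length-S : length S ≤ 6
          v∈S : v ∈ S
          e∈S : e ∈ S
          beside-v : ∀ {t p} → (t , p) ∈ adj v → p ∈ S
          beside-e : ∀ {t p} → p ∈ A → (t , p) ∈ adj e → p ∈ S
          beside-common : ∀ {w t p} → w ∈ A → D adj w v → D adj w e → (t , p) ∈ adj w → p ∈ S
          anchored : ∀ {w} → w ∈ A → w ∈ S → ∃ λ t → ∃ λ p → (t , p) ∈ adj w × p ∈ S

      opaque
        hull : Hull
        hull with Ports.other-elements (degree≤3 v) ve | Ports.other-elements (degree≤3 e) ev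
        ... | (_ , a₁) , (_ , a₂) , va₁ , va₂ , only-v | (_ , q₁) , (_ , q₂) , eq₁ , eq₂ , only-e
          with companion q₁ | companion q₂
        ... | s₁ , common₁ , self₁ | s₂ , common₂ , self₂ = record
          { S = S
          ; length-S = ≤-refl
          ; v∈S = here refl
          ; e∈S = there (here refl)
          ; beside-v = beside-v
          ; beside-e = λ p∈ ep → case only-e ep of λ where
              (here refl) → here refl
              (there (here refl)) → keep p∈ self₁ (there (there (there (there (here refl)))))
              (there (there (here refl))) → keep p∈ self₂ (there (there (there (there (there (here refl))))))
          ; beside-common = λ w∈ wv we wp → case only-e (symm w∈ e∈ we) of λ where
              (here refl) → ⊥-elim (irrefl v∈ wv)
              (there (here refl)) → case common₁ w∈ wv we wp of λ where
                (here refl) → here refl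
                (there (here refl)) → there (here refl)
                (there (there (here refl))) → there (there (there (there (here refl))))
              (there (there (here refl))) → case common₂ w∈ wv we wp of λ where
                (here refl) → here refl
                (there (here refl)) → there (here refl)
                (there (there (here refl))) → there (there (there (there (there (here refl)))))
          ; anchored = λ where
              _ (here refl) → d , e , ve , there (here refl)
              _ (there (here refl)) → d , v , ev , here refl
              w∈ (there (there (here refl))) → _ , v , symm v∈ w∈ va₁ , here refl
              w∈ (there (there (there (here refl)))) → _ , v , symm v∈ w∈ va₂ , here refl
              w∈ (there (there (there (there (here refl))))) → anchor w∈ eq₁ self₁
              w∈ (there (there (there (there (there (here refl)))))) → anchor w∈ eq₂ self₂
          }
          where
          S : List V
          S = v ∷ e ∷ a₁ ∷ a₂ ∷ s₁ ∷ s₂ ∷ []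

          beside-v : ∀ {t p} → (t , p) ∈ adj v → p ∈ S
          beside-v vp with only-v vp
          ... | here refl = there (here refl)
          ... | there (here refl) = there (there (here refl))
          ... | there (there (here refl)) = there (there (there (here refl)))

          keep : ∀ {q s} → q ∈ A → Self q s → s ∈ S → q ∈ S
          keep q∈ (inj₁ refl) s∈ = s∈
          keep q∈ (inj₂ (_ , qv , _)) _ = beside-v (symm q∈ v∈ qv)

          anchor : ∀ {t q s} → s ∈ A → (t , q) ∈ adj e → Self q s → ∃ λ t → ∃ λ p → (t , p) ∈ adj s × p ∈ S
          anchor s∈ eq (inj₁ refl) = _ , e , symm e∈ s∈ eq , there (here refl)
          anchor s∈ _ (inj₂ (q∈ , qv , t , qs)) = t , _ , symm q∈ s∈ qs , beside-v (symm q∈ v∈ qv)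

      open Hull hull public

      A′ : List V
      A′ = A ∖ S

      Rooted : V → Set
      Rooted p = D adj p v ⊎ D adj p e

      -- The ports of `p` are used up by `a`, `b` and one root, so `p` blocks a single pair, and `p`
      -- and `a` determine `b`. A deleted vertex other than `v` and `e` that is not rooted sees only
      -- survivors, at most two of them, and calls for no new edge.
      record Via (p a b : V) : Set where
        field
          dead : p ∈ S
          p∈ : p ∈ A
          pa : D adj p a
          pb : D adj p b
          a≢b : a ≢ b
          a∈ : a ∈ A′
          b∈ : b ∈ A′
          rooted : Rooted p

      via? : ∀ p a b → Dec (Via p a b)
      via? p a b = map′
        (λ (f , g , h , i , j , k , l , n) → record
          { dead = f ; p∈ = g ; pa = h ; pb = i ; a≢b = j ; a∈ = k ; b∈ = l ; rooted = n })
        (λ γ → let open Via γ in dead , p∈ , pa , pb , a≢b , a∈ , b∈ , rooted)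
        ((p ∈? S) ×-dec (p ∈? A) ×-dec ((d , a) ∈ᵖ? adj p) ×-dec ((d , b) ∈ᵖ? adj p) ×-dec ¬? (a ≟ b)
          ×-dec (a ∈? A′) ×-dec (b ∈? A′) ×-dec (((d , v) ∈ᵖ? adj p) ⊎-dec ((d , e) ∈ᵖ? adj p)))

      via-sym : ∀ {p a b} → Via p a b → Via p b a
      via-sym γ = record { dead = dead ; p∈ = p∈ ; pa = pb ; pb = pa ; a≢b = ≢-sym a≢b ; a∈ = b∈ ; b∈ = a∈
        ; rooted = rooted }
        where open Via γ

      via-back : ∀ {p a b} → Via p a b → D adj a p
      via-back γ = symm p∈ (alive a∈) pa
        where open Via γ

      root : ∀ {p} → Rooted p → ∃ λ y → (y ≡ v ⊎ y ≡ e) × D adj p y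
      root (inj₁ pv) = v , inj₁ refl , pv
      root (inj₂ pe) = e , inj₂ refl , pe

      root-∈ : ∀ {y} → y ≡ v ⊎ y ≡ e → y ∈ A
      root-∈ (inj₁ refl) = v∈
      root-∈ (inj₂ refl) = e∈

      root-dead : ∀ {y} → y ≡ v ⊎ y ≡ e → y ∈ S
      root-dead (inj₁ refl) = v∈S
      root-dead (inj₂ refl) = e∈S

      via-ports : ∀ {p a b} (γ : Via p a b) → ∃ λ y → (y ≡ v ⊎ y ≡ e) × D adj p y ×
                  adj p ⊆ (d , a) ∷ (d , b) ∷ (d , y) ∷ []
      via-ports {p} γ = let y , y≡ , py = root rooted in y , y≡ , py ,
        Ports.only-three (degree≤3 p) pa pb py (port-≢ a≢b)
          (port-≢ (dead-≢ a∈ (root-dead y≡))) (port-≢ (dead-≢ b∈ (root-dead y≡)))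
        where open Via γ

      via-survivors : ∀ {p a b t z} → Via p a b → z ∈ A′ → (t , z) ∈ adj p → z ≡ a ⊎ z ≡ b
      via-survivors γ z∈ pz with via-ports γ
      ... | y , y≡ , _ , only with only pz
      ... | here refl = inj₁ refl
      ... | there (here refl) = inj₂ refl
      ... | there (there (here refl)) = ⊥-elim (proj₂ (∈-∖⁻ z∈) (root-dead y≡))

      via-unique : ∀ {p a b b′} → Via p a b → Via p a b′ → b ≡ b′
      via-unique γ γ′ with via-survivors γ (Via.b∈ γ′) (Via.pb γ′)
      ... | inj₁ refl = ⊥-elim (Via.a≢b γ′ refl)
      ... | inj₂ refl = refl

      -- The new edge takes over the port that led to a deleted vertex, so no degree grows.
      reroute : V → Port → Port
      reroute a (c , p) = c , p
      reroute a (d , p) with Fin.any? (via? p a)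
      ... | yes (b , _) = c , b
      ... | no _ = d , p

      adj′ : Ports-of
      adj′ a = map (reroute a) (adj a)

      kept : ∀ {a t b} → b ∉ S → (t , b) ∈ adj a → (t , b) ∈ adj′ a
      kept {a} {t} {b} b∉ ab = subst (_∈ adj′ a) (fixed t) (∈-map⁺ (reroute a) ab)
        where
        fixed : ∀ t → reroute a (t , b) ≡ (t , b)
        fixed c = refl
        fixed d with Fin.any? (via? b a)
        ... | yes (_ , γ) = ⊥-elim (b∉ (Via.dead γ))
        ... | no _ = refl

      added : ∀ {p a b} → Via p a b → C adj′ a b
      added {p} {a} {b} γ = subst (_∈ adj′ a) moved (∈-map⁺ (reroute a) (via-back γ))
        where
        moved : reroute a (d , p) ≡ (c , b)
        moved with Fin.any? (via? p a)
        ... | yes (_ , γ′) = cong (c ,_) (via-unique γ′ γ)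
        ... | no none = ⊥-elim (none (b , γ))

      split : ∀ {a t b} → (t , b) ∈ adj′ a → (t , b) ∈ adj a ⊎ t ≡ c × ∃ λ p → Via p a b
      split {a} ab with ∈-map⁻ (reroute a) ab
      ... | (c , p) , ap , refl = inj₁ ap
      ... | (d , p) , ap , eq with Fin.any? (via? p a)
      ... | yes (_ , γ) with refl ← eq = inj₂ (refl , p , γ)
      ... | no _ with refl ← eq = inj₁ ap

      -- Unlike `C adj′`, this keeps the deleted vertex behind a new edge, from which the reductions
      -- at a K4 choose.
      Link : V → V → Set
      Link a b = C adj a b ⊎ ∃ λ p → Via p a b

      to-link : ∀ {a b} → C adj′ a b → Link a b
      to-link ab with split ab
      ... | inj₁ old = inj₁ old
      ... | inj₂ (_ , new) = inj₂ new

      link-sym : SymmetricOn A′ Link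
      link-sym a∈ b∈ (inj₁ ab) = inj₁ (symm (alive a∈) (alive b∈) ab)
      link-sym a∈ b∈ (inj₂ (p , γ)) = inj₂ (p , via-sym γ)

      link-≢ : ∀ {a b} → a ∈ A′ → Link a b → a ≢ b
      link-≢ a∈ (inj₁ ab) refl = irrefl (alive a∈) ab
      link-≢ a∈ (inj₂ (_ , γ)) = Via.a≢b γ

      Y : List V
      Y = v ∷ e ∷ []

      -- A deleted vertex other than `v` and `e` sees at most two chosen ones: two roots leave no
      -- survivor by `beside-common`, one root leaves one survivor because of the new c-edge, and
      -- `anchored` bounds the survivors by two.
      keep-both : MixedInduction A → K4Free A′ (C adj′) → Third A (Limited A adj)
      keep-both IH free = extend-third S unique
        (IH A′ adj′ (∖-shrinks v∈ v∈S) (∖-unique unique) G′)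
        λ X X⊆ lim → Y , (v≢e ∷ []) ∷ [] ∷ [] ,
          (λ { (here refl) → v∈S ; (there (here refl)) → e∈S }) ,
          (λ { (here refl) → v∈ ; (there (here refl)) → e∈ }) , length-S , extended X X⊆ lim
        where
        G′ : Mixed A′ adj′
        G′ .Mixed.degree≤3 a = ≤-trans (≤-reflexive (length-map (reroute a) (adj a))) (degree≤3 a)
        G′ .Mixed.symm a∈ b∈ ab with split ab
        ... | inj₁ old = kept (proj₂ (∈-∖⁻ a∈)) (symm (alive a∈) (alive b∈) old)
        ... | inj₂ (refl , _ , γ) = added (via-sym γ)
        G′ .Mixed.irrefl a∈ aa with split aa
        ... | inj₁ old = irrefl (alive a∈) old
        ... | inj₂ (_ , _ , γ) = Via.a≢b γ refl
        G′ .Mixed.K4-free = free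

        module _ (X : List V) (X⊆ : X ⊆ A′) (lim : Limited A′ adj′ X) where
          open Limited lim

          fresh : ∀ {x} → x ∈ X → x ∉ S
          fresh = proj₂ ∘ ∈-∖⁻ ∘ X⊆

          side : ∀ {x} → x ∈ Y ++ X → (x ≡ v ⊎ x ≡ e) ⊎ x ∈ X
          side (here refl) = inj₁ (inj₁ refl)
          side (there (here refl)) = inj₁ (inj₂ refl)
          side (there (there x∈)) = inj₂ x∈

          root-apart : ∀ {y x t} → y ≡ v ⊎ y ≡ e → x ∈ X → (t , x) ∉ adj y
          root-apart (inj₁ refl) x∈ vx = fresh x∈ (beside-v vx)
          root-apart (inj₂ refl) x∈ ex = fresh x∈ (beside-e (alive (X⊆ x∈)) ex)

          rooted-at : ∀ {w y} → y ≡ v ⊎ y ≡ e → D adj w y → Rooted w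
          rooted-at (inj₁ refl) = inj₁
          rooted-at (inj₂ refl) = inj₂

          -- Both ends of `ve` may be chosen because no c-edge is parallel to it.
          roots-apart : ∀ {x y} → x ≡ v ⊎ x ≡ e → y ≡ v ⊎ y ≡ e → ¬ C adj x y
          roots-apart (inj₁ refl) (inj₁ refl) = irrefl v∈
          roots-apart (inj₁ refl) (inj₂ refl) = ¬ve
          roots-apart (inj₂ refl) (inj₁ refl) = ¬ve ∘ symm e∈ v∈
          roots-apart (inj₂ refl) (inj₂ refl) = irrefl e∈

          from-X : ∀ {w x} → w ∈ A → w ∉ S → x ∈ Y ++ X → Near adj w x → x ∈ X × Near adj′ w x
          from-X w∈ w∉ x∈ near with side x∈ | near
          ... | inj₂ x∈X | inj₁ eq = x∈X , inj₁ eq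
          ... | inj₂ x∈X | inj₂ wx = x∈X , inj₂ (kept (fresh x∈X) wx)
          ... | inj₁ root | inj₁ refl = ⊥-elim (w∉ (root-dead root))
          ... | inj₁ (inj₁ refl) | inj₂ wx = ⊥-elim (w∉ (beside-v (symm w∈ v∈ wx)))
          ... | inj₁ (inj₂ refl) | inj₂ wx = ⊥-elim (w∉ (beside-e w∈ (symm w∈ e∈ wx)))

          near-root : ∀ {y x} → y ≡ v ⊎ y ≡ e → x ∈ Y ++ X → Near adj y x → x ∈ Y
          near-root {y} is-root x∈ near with side x∈ | near
          ... | inj₁ (inj₁ refl) | _ = here refl
          ... | inj₁ (inj₂ refl) | _ = there (here refl)
          ... | inj₂ x∈X | inj₁ refl = ⊥-elim (fresh x∈X (root-dead is-root))
          ... | inj₂ x∈X | inj₂ yx = ⊥-elim (root-apart is-root x∈X yx)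

          beside : ∀ {w x} → w ∈ S → w ≢ v → w ≢ e → x ∈ Y ++ X → Near adj w x → D adj w x
          beside _ _ _ _ (inj₂ wx) = wx
          beside w∈ w≢v w≢e x∈ (inj₁ refl) with side x∈
          ... | inj₁ (inj₁ refl) = ⊥-elim (w≢v refl)
          ... | inj₁ (inj₂ refl) = ⊥-elim (w≢e refl)
          ... | inj₂ x∈X = ⊥-elim (fresh x∈X w∈)

          two-roots : ∀ {w x y z} → w ∈ A → x ≡ v ⊎ x ≡ e → y ≡ v ⊎ y ≡ e → x ≢ y → D adj w x → D adj w y →
                      z ∈ X → ¬ D adj w z
          two-roots w∈ (inj₁ refl) (inj₁ refl) xy = ⊥-elim (xy refl)
          two-roots w∈ (inj₂ refl) (inj₂ refl) xy = ⊥-elim (xy refl)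
          two-roots w∈ (inj₁ refl) (inj₂ refl) _ wv we z∈ wz = fresh z∈ (beside-common w∈ wv we wz)
          two-roots w∈ (inj₂ refl) (inj₁ refl) _ we wv z∈ wz = fresh z∈ (beside-common w∈ wv we wz)

          one-root : ∀ {w x y z} → w ∈ A → w ∈ S → x ≡ v ⊎ x ≡ e → D adj w x → y ∈ X → z ∈ X → y ≢ z →
                     D adj w y → ¬ D adj w z
          one-root w∈ w∈S is-root wx y∈ z∈ yz wy wz = c-free y∈ z∈ (added record
            { dead = w∈S ; p∈ = w∈ ; pa = wy ; pb = wz ; a≢b = yz ; a∈ = X⊆ y∈ ; b∈ = X⊆ z∈
            ; rooted = rooted-at is-root wx })

          at-deleted : ∀ {w x y z} → w ∈ A → w ∈ S → x ∈ Y ++ X → y ∈ Y ++ X → z ∈ Y ++ X →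
                       x ≢ y → x ≢ z → y ≢ z → D adj w x → D adj w y → ¬ D adj w z
          at-deleted w∈ w∈S x∈ y∈ z∈ xy xz yz wx wy wz with side x∈ | side y∈ | side z∈
          ... | inj₁ rx | inj₁ ry | inj₁ rz = no-three-in-two (in-Y rx) (in-Y ry) (in-Y rz) xy xz yz
            where
            in-Y : ∀ {x} → x ≡ v ⊎ x ≡ e → x ∈ Y
            in-Y (inj₁ refl) = here refl
            in-Y (inj₂ refl) = there (here refl)
          ... | inj₁ rx | inj₁ ry | inj₂ z∈X = two-roots w∈ rx ry xy wx wy z∈X wz
          ... | inj₁ rx | inj₂ y∈X | inj₁ rz = two-roots w∈ rx rz xz wx wz y∈X wy
          ... | inj₂ x∈X | inj₁ ry | inj₁ rz = two-roots w∈ ry rz yz wy wz x∈X wx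
          ... | inj₁ rx | inj₂ y∈X | inj₂ z∈X = one-root w∈ w∈S rx wx y∈X z∈X yz wy wz
          ... | inj₂ x∈X | inj₁ ry | inj₂ z∈X = one-root w∈ w∈S ry wy x∈X z∈X xz wx wz
          ... | inj₂ x∈X | inj₂ y∈X | inj₁ rz = one-root w∈ w∈S rz wz x∈X y∈X xy wx wy
          ... | inj₂ x∈X | inj₂ y∈X | inj₂ z∈X with anchored w∈ w∈S
          ... | _ , u , wu , u∈ = no-four (degree≤3 _) wx wy wz wu (port-≢ xy) (port-≢ xz) (port-≢ (apart x∈X))
            (port-≢ yz) (port-≢ (apart y∈X)) (port-≢ (apart z∈X))
            where
            apart : ∀ {x} → x ∈ X → x ≢ u
            apart x∈ = dead-≢ (X⊆ x∈) u∈

          extended : Limited A adj (Y ++ X)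
          extended .Limited.c-free x∈ y∈ xy with side x∈ | side y∈
          ... | inj₁ rx | inj₁ ry = roots-apart rx ry xy
          ... | inj₁ rx | inj₂ y∈X = root-apart rx y∈X xy
          ... | inj₂ x∈X | inj₁ ry = root-apart ry x∈X (symm (alive (X⊆ x∈X)) (root-∈ ry) xy)
          ... | inj₂ x∈X | inj₂ y∈X = c-free x∈X y∈X (kept (fresh y∈X) xy)
          extended .Limited.d-free {w} w∈ x∈ y∈ z∈ xy xz yz nx ny nz with w ∈? S
          ... | no w∉ =
            let x∈X , nx′ = from-X w∈ w∉ x∈ nx ; y∈X , ny′ = from-X w∈ w∉ y∈ ny
                z∈X , nz′ = from-X w∈ w∉ z∈ nz in
            d-free (∈-∖⁺ w∈ w∉) x∈X y∈X z∈X xy xz yz nx′ ny′ nz′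
          ... | yes w∈S with w ≟ v | w ≟ e
          ... | yes eq | _ = no-three-in-two (near-root (inj₁ eq) x∈ nx) (near-root (inj₁ eq) y∈ ny)
                               (near-root (inj₁ eq) z∈ nz) xy xz yz
          ... | no _ | yes eq = no-three-in-two (near-root (inj₂ eq) x∈ nx) (near-root (inj₂ eq) y∈ ny)
                                  (near-root (inj₂ eq) z∈ nz) xy xz yz
          ... | no w≢v | no w≢e = at-deleted w∈ w∈S x∈ y∈ z∈ xy xz yz (beside w∈S w≢v w≢e x∈ nx)
                                    (beside w∈S w≢v w≢e y∈ ny) (beside w∈S w≢v w≢e z∈ nz)

      -- K4s closed by new edges.

      LinkedK4 : V → V → V → V → Set
      LinkedK4 = K4 A′ Link

      link-port : ∀ {a b} → Link a b → Port
      link-port {b = b} (inj₁ _) = c , b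
      link-port (inj₂ (g , _)) = d , g

      link-port-∈ : ∀ {a b} (ℓ : Link a b) → link-port ℓ ∈ adj a
      link-port-∈ (inj₁ ab) = ab
      link-port-∈ (inj₂ (_ , γ)) = via-back γ

      link-port-≢ : ∀ {a b b′} → b ≢ b′ → (ℓ : Link a b) (ℓ′ : Link a b′) → link-port ℓ ≢ link-port ℓ′
      link-port-≢ b≢b′ (inj₁ _) (inj₁ _) eq = b≢b′ (cong proj₂ eq)
      link-port-≢ b≢b′ (inj₂ (_ , γ)) (inj₂ (_ , γ′)) refl = b≢b′ (via-unique γ γ′)

      -- The three links at a corner use distinct ports and so exhaust its degree: in the original
      -- graph a corner has no neighbours but corners and deleted vertices behind new edges.
      K4-ports : ∀ {p q r s} (Q : LinkedK4 p q r s) →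
                 adj p ⊆ link-port (K4.pq Q) ∷ link-port (K4.pr Q) ∷ link-port (K4.ps Q) ∷ []
      K4-ports {p} Q = Ports.only-three (degree≤3 p) (link-port-∈ pq) (link-port-∈ pr) (link-port-∈ ps)
        (link-port-≢ (link-≢ q∈ qr) pq pr) (link-port-≢ (link-≢ q∈ qs) pq ps) (link-port-≢ (link-≢ r∈ rs) pr ps)
        where open K4 Q

      In : List V → ∀ {a b} → Link a b → Set
      In T (inj₁ _) = ⊤
      In T (inj₂ (g , _)) = g ∈ T

      In-sym : ∀ {T a b} (a∈ : a ∈ A′) (b∈ : b ∈ A′) (ℓ : Link a b) → In T ℓ → In T (link-sym a∈ b∈ ℓ)
      In-sym _ _ (inj₁ _) _ = tt
      In-sym _ _ (inj₂ _) g∈ = g∈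

      port-in : ∀ {T a b t z} (ℓ : Link a b) → b ∈ T → In T ℓ → (t , z) ≡ link-port ℓ → z ∈ T
      port-in (inj₁ _) b∈ _ refl = b∈
      port-in (inj₂ _) _ g∈ refl = g∈

      corner-interior : ∀ {T p q r s} (Q : LinkedK4 p q r s) → q ∈ T → r ∈ T → s ∈ T →
        In T (K4.pq Q) → In T (K4.pr Q) → In T (K4.ps Q) → Interior T p
      corner-interior Q q∈ r∈ s∈ iq ir is _ pz with K4-ports Q pz
      ... | here eq = port-in (K4.pq Q) q∈ iq eq
      ... | there (here eq) = port-in (K4.pr Q) r∈ ir eq
      ... | there (there (here eq)) = port-in (K4.ps Q) s∈ is eq

      corner-d : ∀ {p q r s z} (Q : LinkedK4 p q r s) → D adj p z → ∃ λ b → Via z p b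
      corner-d Q pz with K4.pq Q | K4.pr Q | K4.ps Q | K4-ports Q pz
      ... | inj₂ (_ , γ) | _ | _ | here refl = _ , γ
      ... | _ | inj₂ (_ , γ) | _ | there (here refl) = _ , γ
      ... | _ | _ | inj₂ (_ , γ) | there (there (here refl)) = _ , γ

      -- A c-edge `pq` beside the path through `g` would be a fourth port at `p`. Hence both ends of
      -- a new edge may be chosen together.
      corner-c : ∀ {p q r s g} → LinkedK4 p q r s → Via g p q → ¬ C adj p q
      corner-c {p} Q γ pq′ = no-four (degree≤3 p) (via-back γ) pq′ (link-port-∈ pr) (link-port-∈ ps)
        (λ ()) (link-port-≢ q≢r (inj₂ (_ , γ)) pr) (link-port-≢ q≢s (inj₂ (_ , γ)) ps)
        (link-port-≢ q≢r (inj₁ pq′) pr) (link-port-≢ q≢s (inj₁ pq′) ps) (link-port-≢ (link-≢ r∈ rs) pr ps)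
        where
        open K4 Q
        q≢r = link-≢ q∈ qr
        q≢s = link-≢ q∈ qs

      via-interior : ∀ {T g a b} → Via g a b → a ∈ T → b ∈ T → v ∈ T → e ∈ T → Interior T g
      via-interior γ a∈ b∈ v∈T e∈T _ gz with via-ports γ
      ... | y , y≡ , _ , only with only gz
      ... | here refl = a∈
      ... | there (here refl) = b∈
      ... | there (there (here refl)) with y≡
      ... | inj₁ refl = v∈T
      ... | inj₂ refl = e∈T

      via-d : ∀ {g a b z} → Via g a b → ¬ C adj g z
      via-d γ gz with via-ports γ
      ... | _ , _ , _ , only with only gz
      ... | there (there (there ()))

      -- All live neighbours of a root are deleted, while `g` has surviving ones.
      via-≢-root : ∀ {g a b y} → Via g a b → y ≡ v ⊎ y ≡ e → g ≢ y
      via-≢-root γ (inj₁ refl) refl = proj₂ (∈-∖⁻ (Via.a∈ γ)) (beside-v (Via.pa γ))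
      via-≢-root γ (inj₂ refl) refl = proj₂ (∈-∖⁻ (Via.a∈ γ)) (beside-e (alive (Via.a∈ γ)) (Via.pa γ))

      via-≢-survivor : ∀ {g a b x} → Via g a b → x ∈ A′ → x ≢ g
      via-≢-survivor γ x∈ = dead-≢ x∈ (Via.dead γ)

      root-far : ∀ {x y} → y ≡ v ⊎ y ≡ e → x ∈ A′ → ¬ D adj y x
      root-far (inj₁ refl) x∈ vx = proj₂ (∈-∖⁻ x∈) (beside-v vx)
      root-far (inj₂ refl) x∈ ex = proj₂ (∈-∖⁻ x∈) (beside-e (alive x∈) ex)

      -- Call the deleted vertex behind a new edge its connector. The four corners of a K4 in the new
      -- graph, its k connectors and v, e form a set of 6 + k vertices that only v and e can leave.
      -- With pq new we may choose p and q, plus another connector if k ≥ 2; if moreover rs is new,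
      -- then its connector is near neither p nor q, so that both it and a further connector may be
      -- chosen when k ≥ 3, and 6 + k ≤ 12. If no two opposite edges are new, then k ≤ 3. For k = 1
      -- only the root adjacent to the connector has to be deleted.
      module AtK4 (IH : MixedInduction A) {p q r s : V} (Q : LinkedK4 p q r s) where
        private module Q = K4 Q

        swapped : LinkedK4 q p r s
        swapped = K4-swap₁₂ link-sym Q

        p≢q : p ≢ q
        p≢q = link-≢ Q.p∈ Q.pq

        corners : List V
        corners = p ∷ q ∷ r ∷ s ∷ []

        corner-first : ∀ {x} → x ∈ corners → ∃ λ q′ → ∃ λ r′ → ∃ λ s′ → LinkedK4 x q′ r′ s′
        corner-first (here refl) = _ , _ , _ , Q
        corner-first (there (here refl)) = _ , _ , _ , swapped
        corner-first (there (there (here refl))) = _ , _ , _ , K4-swap₁₂ link-sym (K4-swap₂₃ link-sym Q)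
        corner-first (there (there (there (here refl)))) =
          _ , _ , _ , K4-swap₁₂ link-sym (K4-swap₂₃ link-sym (K4-swap₃₄ link-sym Q))

        corners-apart : ∀ {x y} → x ∈ corners → y ∈ A′ → ¬ D adj x y
        corners-apart x∈ y∈ xy = let _ , _ , _ , Q′ = corner-first x∈ ; _ , γ = corner-d Q′ xy in
          proj₂ (∈-∖⁻ y∈) (Via.dead γ)

        corners-interior : ∀ {T} → corners ⊆ T → In T Q.pq → In T Q.pr → In T Q.ps → In T Q.qr →
          In T Q.qs → In T Q.rs → ∀ {x} → x ∈ corners → Interior T x
        corners-interior sub ipq ipr ips iqr iqs irs = λ where
            (here refl) → corner-interior Q q∈ r∈ s∈ ipq ipr ips
            (there (here refl)) → corner-interior swapped p∈ r∈ s∈ (In-sym Q.p∈ Q.q∈ Q.pq ipq) iqr iqs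
            (there (there (here refl))) → corner-interior (K4-swap₁₂ link-sym (K4-swap₂₃ link-sym Q))
              p∈ q∈ s∈ (In-sym Q.p∈ Q.r∈ Q.pr ipr) (In-sym Q.q∈ Q.r∈ Q.qr iqr) irs
            (there (there (there (here refl)))) →
              corner-interior (K4-swap₁₂ link-sym (K4-swap₂₃ link-sym (K4-swap₃₄ link-sym Q)))
                p∈ q∈ r∈ (In-sym Q.p∈ Q.s∈ Q.ps ips) (In-sym Q.q∈ Q.s∈ Q.qs iqs) (In-sym Q.r∈ Q.s∈ Q.rs irs)
          where
          p∈ = sub (here refl)
          q∈ = sub (there (here refl))
          r∈ = sub (there (there (here refl)))
          s∈ = sub (there (there (there (here refl))))

        Connector : V → Set
        Connector g = ∃ λ a → ∃ λ b → a ∈ corners × b ∈ corners × Via g a b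

        roots-spoiled : ∀ {T Y y} → y ≡ v ⊎ y ≡ e → v ∈ T → e ∈ T → v ∉ Y → e ∉ Y → Spoiled T Y y
        roots-spoiled (inj₁ refl) v∈T e∈T v∉ e∉ = v∉ , d , e , ve , e∈T , e∉
        roots-spoiled (inj₂ refl) v∈T e∈T v∉ e∉ = e∉ , d , v , ev , v∈T , v∉

        choosable-c-free : ∀ {Y} → ¬ C adj p q → (∀ {y} → y ∈ Y → (y ≡ p ⊎ y ≡ q) ⊎ Connector y) →
          ∀ {x y} → x ∈ Y → y ∈ Y → ¬ C adj x y
        choosable-c-free ¬pq kind x∈ y∈ xy with kind x∈ | kind y∈
        ... | inj₂ (_ , _ , _ , _ , γ) | _ = via-d γ xy
        ... | inj₁ (inj₁ refl) | inj₂ (_ , _ , _ , _ , γ) = via-d γ (symm (alive Q.p∈) (Via.p∈ γ) xy)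
        ... | inj₁ (inj₂ refl) | inj₂ (_ , _ , _ , _ , γ) = via-d γ (symm (alive Q.q∈) (Via.p∈ γ) xy)
        ... | inj₁ (inj₁ refl) | inj₁ (inj₁ refl) = irrefl (alive Q.p∈) xy
        ... | inj₁ (inj₁ refl) | inj₁ (inj₂ refl) = ¬pq xy
        ... | inj₁ (inj₂ refl) | inj₁ (inj₁ refl) = ¬pq (symm (alive Q.q∈) (alive Q.p∈) xy)
        ... | inj₁ (inj₂ refl) | inj₁ (inj₂ refl) = irrefl (alive Q.q∈) xy

        -- No d-edge joins `p` and `q`, so a common `w` is d-adjacent to both. Unless it is `g`, it
        -- is a connector of `p` and `q`, and its ports to `p`, `q` and a root leave no room for
        -- `g`.
        no-common : ∀ {w g a b} → w ∈ A → Via g a b → ¬ (D adj g p × D adj g q) →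
          Near adj w p → Near adj w q → ¬ Near adj w g
        no-common w∈ γ ¬gpq (inj₁ refl) (inj₁ eq) _ = p≢q (sym eq)
        no-common w∈ γ ¬gpq (inj₁ refl) (inj₂ pq) _ = corners-apart (here refl) Q.q∈ pq
        no-common w∈ γ ¬gpq (inj₂ qp) (inj₁ refl) _ = corners-apart (there (here refl)) Q.p∈ qp
        no-common w∈ γ ¬gpq (inj₂ wp) (inj₂ wq) (inj₁ refl) = ¬gpq (wp , wq)
        no-common w∈ γ ¬gpq (inj₂ wp) (inj₂ wq) (inj₂ wg) with corner-d Q (symm w∈ (alive Q.p∈) wp)
        ... | _ , δ with via-survivors δ Q.q∈ wq
        ... | inj₁ refl = p≢q refl
        ... | inj₂ refl with via-ports δ
        ... | y , y≡ , _ , only with only wg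
        ... | here refl = via-≢-survivor γ Q.p∈ refl
        ... | there (here refl) = via-≢-survivor γ Q.q∈ refl
        ... | there (there (here refl)) = via-≢-root γ y≡ refl

        -- The only neighbours of `g` are `a`, `b` and a root. None of them is `x`, and none is
        -- d-adjacent to the survivor `x`: corners have d-edges to connectors only, and live
        -- neighbours of roots are deleted.
        no-common-opposite : ∀ {w g x a b} → w ∈ A → a ∈ corners → b ∈ corners → Via g a b →
          x ∈ A′ → x ≢ a → x ≢ b → Near adj w x → ¬ Near adj w g
        no-common-opposite w∈ a∈ b∈ γ x∈ xa xb (inj₁ refl) (inj₁ eq) = via-≢-survivor γ x∈ (sym eq)
        no-common-opposite w∈ a∈ b∈ γ x∈ xa xb (inj₁ refl) (inj₂ xg)
          with via-survivors γ x∈ (symm (alive x∈) (Via.p∈ γ) xg)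
        ... | inj₁ eq = xa eq
        ... | inj₂ eq = xb eq
        no-common-opposite w∈ a∈ b∈ γ x∈ xa xb (inj₂ gx) (inj₁ refl) with via-survivors γ x∈ gx
        ... | inj₁ eq = xa eq
        ... | inj₂ eq = xb eq
        no-common-opposite w∈ a∈ b∈ γ x∈ xa xb (inj₂ wx) (inj₂ wg) with via-ports γ
        ... | y , y≡ , _ , only with only (symm w∈ (Via.p∈ γ) wg)
        ... | here refl = corners-apart a∈ x∈ wx
        ... | there (here refl) = corners-apart b∈ x∈ wx
        ... | there (there (here refl)) = root-far y≡ x∈ wx

        record Connectors (cs : List V) : Set where
          field
            connectors : ∀ {g} → g ∈ cs → Connector g
            pq-in : In cs Q.pq
            pr-in : In cs Q.pr
            ps-in : In cs Q.ps
            qr-in : In cs Q.qr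
            qs-in : In cs Q.qs
            rs-in : In cs Q.rs

        module _ {cs : List V} (K : Connectors cs) {z : V} (γ₀ : Via z p q) where
          open Connectors K

          private
            T : List V
            T = p ∷ q ∷ r ∷ s ∷ v ∷ e ∷ cs

            corner-T : corners ⊆ T
            corner-T (here refl) = here refl
            corner-T (there (here refl)) = there (here refl)
            corner-T (there (there (here refl))) = there (there (here refl))
            corner-T (there (there (there (here refl)))) = there (there (there (here refl)))

            v∈T : v ∈ T
            v∈T = there (there (there (there (here refl))))

            e∈T : e ∈ T
            e∈T = there (there (there (there (there (here refl)))))

            cs-T : cs ⊆ T
            cs-T g∈ = there (there (there (there (there (there g∈)))))

            In-T : ∀ {a b} (ℓ : Link a b) → In cs ℓ → In T ℓ
            In-T (inj₁ _) _ = tt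
            In-T (inj₂ _) g∈ = cs-T g∈

            T-interior : ∀ {x} → x ∈ corners → Interior T x
            T-interior = corners-interior corner-T (In-T Q.pq pq-in) (In-T Q.pr pr-in) (In-T Q.ps ps-in)
              (In-T Q.qr qr-in) (In-T Q.qs qs-in) (In-T Q.rs rs-in)

          -- The roots may have neighbours outside `T`, but they are unchosen and adjacent, so each
          -- spoils the other. All other vertices of `T` are interior.
          delete-connected : (Y : List V) → Unique Y → p ∈ Y → length T ≤ 3 * length Y →
            (∀ {y} → y ∈ Y → (y ≡ p ⊎ y ≡ q) ⊎ y ∈ cs) →
            (∀ {w x y z} → w ∈ A → x ∈ Y → y ∈ Y → z ∈ Y → x ≢ y → x ≢ z → y ≢ z →
              Near adj w x → Near adj w y → ¬ Near adj w z) →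
            Third A (Limited A adj)
          delete-connected Y uY p∈Y len kind = delete-set IH T Y uY Y-T Y-A (p , p∈Y) len classify
            (choosable-c-free (corner-c Q γ₀) λ y∈ → case kind y∈ of λ where
              (inj₁ eq) → inj₁ eq
              (inj₂ y∈cs) → inj₂ (connectors y∈cs))
            where
            Y-T : Y ⊆ T
            Y-T y∈ with kind y∈
            ... | inj₁ (inj₁ refl) = here refl
            ... | inj₁ (inj₂ refl) = there (here refl)
            ... | inj₂ y∈cs = cs-T y∈cs

            Y-A : Y ⊆ A
            Y-A y∈ with kind y∈
            ... | inj₁ (inj₁ refl) = alive Q.p∈
            ... | inj₁ (inj₂ refl) = alive Q.q∈
            ... | inj₂ y∈cs = let _ , _ , _ , _ , γ = connectors y∈cs in Via.p∈ γ

            no-root : ∀ {y} → y ≡ v ⊎ y ≡ e → y ∉ Y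
            no-root y≡ y∈ with kind y∈
            ... | inj₁ (inj₁ refl) = dead-≢ Q.p∈ (root-dead y≡) refl
            ... | inj₁ (inj₂ refl) = dead-≢ Q.q∈ (root-dead y≡) refl
            ... | inj₂ y∈cs = let _ , _ , _ , _ , γ = connectors y∈cs in via-≢-root γ y≡ refl

            spoiled : ∀ {y} → y ≡ v ⊎ y ≡ e → Spoiled T Y y
            spoiled y≡ = roots-spoiled y≡ v∈T e∈T (no-root (inj₁ refl)) (no-root (inj₂ refl))

            classify : ∀ {w} → w ∈ A → w ∈ T → Interior T w ⊎ Spoiled T Y w
            classify _ (here refl) = inj₁ (T-interior (here refl))
            classify _ (there (here refl)) = inj₁ (T-interior (there (here refl)))
            classify _ (there (there (here refl))) = inj₁ (T-interior (there (there (here refl))))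
            classify _ (there (there (there (here refl)))) = inj₁ (T-interior (there (there (there (here refl)))))
            classify _ (there (there (there (there (here refl))))) = inj₂ (spoiled (inj₁ refl))
            classify _ (there (there (there (there (there (here refl)))))) = inj₂ (spoiled (inj₂ refl))
            classify _ (there (there (there (there (there (there g∈)))))) =
              let _ , _ , a∈ , b∈ , γ = connectors g∈ in
              inj₁ (via-interior γ (corner-T a∈) (corner-T b∈) v∈T e∈T)

          -- At most nine deletions are paid for by `p`, `q` and `g`, and `no-common` shows that no
          -- vertex sees all three.
          choose-three : ∀ {g a b} → length cs ≤ 3 → g ∈ cs → Via g a b → ¬ (D adj g p × D adj g q) →
            Third A (Limited A adj)
          choose-three {g} len g∈ γ ¬gpq = delete-connected (p ∷ q ∷ g ∷ [])
            ((p≢q ∷ via-≢-survivor γ Q.p∈ ∷ []) ∷ (via-≢-survivor γ Q.q∈ ∷ []) ∷ [] ∷ [])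
            (here refl) (s≤s (s≤s (s≤s (s≤s (s≤s (s≤s len))))))
            (λ { (here refl) → inj₁ (inj₁ refl) ; (there (here refl)) → inj₁ (inj₂ refl)
               ; (there (there (here refl))) → inj₂ g∈ })
            λ {w} w∈ x∈ y∈ z∈ xy xz yz nx ny nz →
              let np , nq , ng = all-three {P = Near adj w} x∈ y∈ z∈ xy xz yz nx ny nz in
              no-common w∈ γ ¬gpq np nq ng

          -- A vertex near `z′` is near neither `p` nor `q`, which leaves `g` and `z′`. Any other
          -- vertex could only see `p`, `q` and `g`, but not all of them by `no-common`.
          choose-four : ∀ {g a b z′} → length cs ≤ 6 → g ∈ cs → Via g a b → ¬ (D adj g p × D adj g q) →
            z′ ∈ cs → Via z′ r s → g ≢ z′ → Third A (Limited A adj)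
          choose-four {g} {z′ = z′} len g∈ γ ¬gpq z′∈ γ′ g≢z′ = delete-connected (p ∷ q ∷ g ∷ z′ ∷ [])
            ((p≢q ∷ via-≢-survivor γ Q.p∈ ∷ via-≢-survivor γ′ Q.p∈ ∷ []) ∷
              (via-≢-survivor γ Q.q∈ ∷ via-≢-survivor γ′ Q.q∈ ∷ []) ∷ (g≢z′ ∷ []) ∷ [] ∷ [])
            (here refl) (s≤s (s≤s (s≤s (s≤s (s≤s (s≤s len))))))
            (λ { (here refl) → inj₁ (inj₁ refl) ; (there (here refl)) → inj₁ (inj₂ refl)
               ; (there (there (here refl))) → inj₂ g∈ ; (there (there (there (here refl)))) → inj₂ z′∈ })
            d-freeY
            where
            near-z′ : ∀ {w x} → w ∈ A → Near adj w z′ → x ∈ p ∷ q ∷ g ∷ z′ ∷ [] → Near adj w x → x ∈ g ∷ z′ ∷ []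
            near-z′ w∈ nz′ (here refl) np = ⊥-elim (no-common-opposite w∈ (there (there (here refl)))
              (there (there (there (here refl)))) γ′ Q.p∈ (link-≢ Q.p∈ Q.pr) (link-≢ Q.p∈ Q.ps) np nz′)
            near-z′ w∈ nz′ (there (here refl)) nq = ⊥-elim (no-common-opposite w∈ (there (there (here refl)))
              (there (there (there (here refl)))) γ′ Q.q∈ (link-≢ Q.q∈ Q.qr) (link-≢ Q.q∈ Q.qs) nq nz′)
            near-z′ _ _ (there (there x∈)) _ = x∈

            not-z′ : ∀ {w x} → ¬ Near adj w z′ → x ∈ p ∷ q ∷ g ∷ z′ ∷ [] → Near adj w x → x ∈ p ∷ q ∷ g ∷ []
            not-z′ _ (here eq) _ = here eq
            not-z′ _ (there (here eq)) _ = there (here eq)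
            not-z′ _ (there (there (here eq))) _ = there (there (here eq))
            not-z′ ¬nz′ (there (there (there (here refl)))) nx = ⊥-elim (¬nz′ nx)

            d-freeY : ∀ {w x y u} → w ∈ A → x ∈ p ∷ q ∷ g ∷ z′ ∷ [] → y ∈ p ∷ q ∷ g ∷ z′ ∷ [] →
              u ∈ p ∷ q ∷ g ∷ z′ ∷ [] → x ≢ y → x ≢ u → y ≢ u → Near adj w x → Near adj w y → ¬ Near adj w u
            d-freeY {w} w∈ x∈ y∈ u∈ xy xu yu nx ny nu with near? w z′
            ... | yes nz′ = no-three-in-two (near-z′ w∈ nz′ x∈ nx) (near-z′ w∈ nz′ y∈ ny) (near-z′ w∈ nz′ u∈ nu)
                              xy xu yu
            ... | no ¬nz′ =
              let np , nq , ng = all-three {P = Near adj w} (not-z′ ¬nz′ x∈ nx) (not-z′ ¬nz′ y∈ ny)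
                                   (not-z′ ¬nz′ u∈ nu) xy xu yu nx ny nu in
              no-common w∈ γ ¬gpq np nq ng

        -- Choosing `p` and `q` pays for six deletions, hence for the corners, `z` and one root. The
        -- root `y` next to `z` is taken: its port to the unchosen `z` spoils it, and `z` becomes
        -- interior. The other root stays in the graph.
        choose-two : ∀ {z} → Via z p q → In (z ∷ []) Q.pq → In [] Q.pr → In [] Q.ps → In [] Q.qr →
          In [] Q.qs → In [] Q.rs → Third A (Limited A adj)
        choose-two {z} γ ipq ipr ips iqr iqs irs with via-ports γ
        ... | y , y≡ , zy , only = delete-set IH T (p ∷ q ∷ []) ((p≢q ∷ []) ∷ [] ∷ [])
          (λ { (here refl) → here refl ; (there (here refl)) → there (here refl) })
          (λ { (here refl) → alive Q.p∈ ; (there (here refl)) → alive Q.q∈ })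
          (p , here refl) ≤-refl classify
          (choosable-c-free (corner-c Q γ) λ { (here eq) → inj₁ (inj₁ eq) ; (there (here eq)) → inj₁ (inj₂ eq) })
          λ _ x∈ y∈ z∈ xy xz yz _ _ _ → no-three-in-two x∈ y∈ z∈ xy xz yz
          where
          T : List V
          T = p ∷ q ∷ r ∷ s ∷ z ∷ y ∷ []

          corner-T : corners ⊆ T
          corner-T (here refl) = here refl
          corner-T (there (here refl)) = there (here refl)
          corner-T (there (there (here refl))) = there (there (here refl))
          corner-T (there (there (there (here refl)))) = there (there (there (here refl)))

          In-T : ∀ {cs a b} → (∀ {x} → x ∈ cs → x ∈ z ∷ []) → (ℓ : Link a b) → In cs ℓ → In T ℓ
          In-T sub (inj₁ _) _ = tt
          In-T sub (inj₂ _) g∈ with sub g∈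
          ... | here refl = there (there (there (there (here refl))))

          T-interior : ∀ {x} → x ∈ corners → Interior T x
          T-interior = corners-interior corner-T (In-T id Q.pq ipq) (In-T there Q.pr ipr) (In-T there Q.ps ips)
            (In-T there Q.qr iqr) (In-T there Q.qs iqs) (In-T there Q.rs irs)

          y∉ : y ∉ p ∷ q ∷ []
          y∉ (here refl) = dead-≢ Q.p∈ (root-dead y≡) refl
          y∉ (there (here refl)) = dead-≢ Q.q∈ (root-dead y≡) refl

          z∉ : z ∉ p ∷ q ∷ []
          z∉ (here refl) = via-≢-survivor γ Q.p∈ refl
          z∉ (there (here refl)) = via-≢-survivor γ Q.q∈ refl

          classify : ∀ {w} → w ∈ A → w ∈ T → Interior T w ⊎ Spoiled T (p ∷ q ∷ []) w
          classify _ (here refl) = inj₁ (T-interior (here refl))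
          classify _ (there (here refl)) = inj₁ (T-interior (there (here refl)))
          classify _ (there (there (here refl))) = inj₁ (T-interior (there (there (here refl))))
          classify _ (there (there (there (here refl)))) = inj₁ (T-interior (there (there (there (here refl)))))
          classify _ (there (there (there (there (here refl))))) = inj₁ λ _ zx → case only zx of λ where
            (here refl) → here refl
            (there (here refl)) → there (here refl)
            (there (there (here refl))) → there (there (there (there (there (here refl)))))
          classify _ (there (there (there (there (there (here refl)))))) = inj₂ (y∉ , d , z ,
            symm (Via.p∈ γ) (root-∈ y≡) zy , there (there (there (there (here refl)))) , z∉)

      via-misses : ∀ {g a b x} → Via g a b → x ∈ A′ → x ≢ a → x ≢ b → ¬ D adj g x
      via-misses γ x∈ xa xb gx with via-survivors γ x∈ gx
      ... | inj₁ eq = xa eq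
      ... | inj₂ eq = xb eq

      -- The default `z` pads the list of connectors where the link is an old c-edge, so that one
      -- list of fixed length serves all cases.
      connector-or : V → ∀ {a b} → Link a b → V
      connector-or z (inj₁ _) = z
      connector-or _ (inj₂ (g , _)) = g

      connector-or-in : ∀ {z cs a b} (ℓ : Link a b) → connector-or z ℓ ∈ cs → In cs ℓ
      connector-or-in (inj₁ _) _ = tt
      connector-or-in (inj₂ _) g∈ = g∈

      module SplitK4 (IH : MixedInduction A) {p q r s z : V}
        (p∈ : p ∈ A′) (q∈ : q ∈ A′) (r∈ : r ∈ A′) (s∈ : s ∈ A′) (γ : Via z p q)
        (pr : Link p r) (ps : Link p s) (qr : Link q r) (qs : Link q s) where

        private
          p≢q = Via.a≢b γ
          p≢r = link-≢ p∈ pr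
          p≢s = link-≢ p∈ ps
          q≢r = link-≢ q∈ qr
          q≢s = link-≢ q∈ qs

          p∈′ : ∀ {xs} → p ∈ p ∷ xs
          p∈′ = here refl
          q∈′ : ∀ {x xs} → q ∈ x ∷ q ∷ xs
          q∈′ = there (here refl)
          r∈′ : ∀ {x y xs} → r ∈ x ∷ y ∷ r ∷ xs
          r∈′ = there (there (here refl))
          s∈′ : ∀ {x y z xs} → s ∈ x ∷ y ∷ z ∷ s ∷ xs
          s∈′ = there (there (there (here refl)))

        one-of : ∀ {g x y} → x ≡ p ⊎ x ≡ q → p ≢ y → q ≢ y → Via g x y → ¬ (D adj g p × D adj g q)
        one-of (inj₁ refl) _ qy δ (_ , gq) = via-misses δ q∈ (≢-sym p≢q) qy gq
        one-of (inj₂ refl) py _ δ (gp , _) = via-misses δ p∈ p≢q py gp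

        -- `g₂` sits behind an edge sharing just one end with `pq`, hence is not d-adjacent to both
        -- `p` and `q`, as `choose-three` demands. `g₃` serves a third new edge or repeats an
        -- earlier connector.
        few : (rs : Link r s) → ∀ {g₂ x y g₃ a b} → x ≡ p ⊎ x ≡ q → y ≡ r ⊎ y ≡ s → Via g₂ x y →
          a ∈ p ∷ q ∷ r ∷ s ∷ [] → b ∈ p ∷ q ∷ r ∷ s ∷ [] → Via g₃ a b →
          In (z ∷ g₂ ∷ g₃ ∷ []) pr → In (z ∷ g₂ ∷ g₃ ∷ []) ps → In (z ∷ g₂ ∷ g₃ ∷ []) qr →
          In (z ∷ g₂ ∷ g₃ ∷ []) qs → In (z ∷ g₂ ∷ g₃ ∷ []) rs → Third A (Limited A adj)
        few rs {g₂} {x} {y} {g₃} x≡ y≡ δ₂ a∈ b∈ δ₃ ipr ips iqr iqs irs = Q.choose-three {cs = z ∷ g₂ ∷ g₃ ∷ []}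
          (record { connectors = λ where
                      (here refl) → _ , _ , p∈′ , q∈′ , γ
                      (there (here refl)) → _ , _ , x∈ x≡ , y∈ y≡ , δ₂
                      (there (there (here refl))) → _ , _ , a∈ , b∈ , δ₃
                  ; pq-in = here refl ; pr-in = ipr ; ps-in = ips ; qr-in = iqr ; qs-in = iqs ; rs-in = irs })
          γ ≤-refl (there (here refl)) δ₂ (crossing y≡)
          where
          Q : LinkedK4 p q r s
          Q = record { p∈ = p∈ ; q∈ = q∈ ; r∈ = r∈ ; s∈ = s∈ ; pq = inj₂ (z , γ) ; pr = pr
            ; ps = ps ; qr = qr ; qs = qs ; rs = rs }

          module Q = AtK4 IH Q

          x∈ : x ≡ p ⊎ x ≡ q → x ∈ p ∷ q ∷ r ∷ s ∷ []
          x∈ (inj₁ refl) = p∈′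
          x∈ (inj₂ refl) = q∈′
          y∈ : y ≡ r ⊎ y ≡ s → y ∈ p ∷ q ∷ r ∷ s ∷ []
          y∈ (inj₁ refl) = r∈′
          y∈ (inj₂ refl) = s∈′
          crossing : y ≡ r ⊎ y ≡ s → ¬ (D adj g₂ p × D adj g₂ q)
          crossing (inj₁ refl) = one-of x≡ p≢r q≢r δ₂
          crossing (inj₂ refl) = one-of x≡ p≢s q≢s δ₂

        -- If one of the four other edges is new, its connector becomes the fourth choice, and six
        -- connectors are affordable. Otherwise `z` and `z′` are the only ones, and `z′` is the
        -- third choice.
        opposite : ∀ {z′} → Via z′ r s → Third A (Limited A adj)
        opposite {z′} γ′ = go pr ps qr qs refl refl refl refl
          where
          Q : LinkedK4 p q r s
          Q = record { p∈ = p∈ ; q∈ = q∈ ; r∈ = r∈ ; s∈ = s∈ ; pq = inj₂ (z , γ) ; pr = pr ; ps = ps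
            ; qr = qr ; qs = qs ; rs = inj₂ (z′ , γ′) }

          module Q = AtK4 IH Q

          z-connector : Q.Connector z
          z-connector = p , q , p∈′ , q∈′ , γ

          z′-connector : Q.Connector z′
          z′-connector = r , s , r∈′ , s∈′ , γ′

          is-connector : ∀ {a b} (ℓ : Link a b) → a ∈ Q.corners → b ∈ Q.corners →
            Q.Connector (connector-or z ℓ)
          is-connector (inj₁ _) _ _ = z-connector
          is-connector (inj₂ (_ , δ)) a∈ b∈ = _ , _ , a∈ , b∈ , δ

          cs : List V
          cs = z ∷ z′ ∷ connector-or z pr ∷ connector-or z ps ∷ connector-or z qr ∷ connector-or z qs ∷ []

          all-connectors : Q.Connectors cs
          all-connectors = record
            { connectors = λ where
                (here refl) → z-connector
                (there (here refl)) → z′-connector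
                (there (there (here refl))) → is-connector pr p∈′ r∈′
                (there (there (there (here refl)))) → is-connector ps p∈′ s∈′
                (there (there (there (there (here refl))))) → is-connector qr q∈′ r∈′
                (there (there (there (there (there (here refl)))))) → is-connector qs q∈′ s∈′
            ; pq-in = here refl
            ; pr-in = connector-or-in pr (there (there (here refl)))
            ; ps-in = connector-or-in ps (there (there (there (here refl))))
            ; qr-in = connector-or-in qr (there (there (there (there (here refl)))))
            ; qs-in = connector-or-in qs (there (there (there (there (there (here refl))))))
            ; rs-in = there (here refl)
            }

          with-fourth : ∀ {g x y} → g ∈ cs → x ≡ p ⊎ x ≡ q → y ≡ r ⊎ y ≡ s → Via g x y →
            Third A (Limited A adj)
          with-fourth {g} {x} {y} g∈ x≡ y≡ δ = Q.choose-four all-connectors γ ≤-refl g∈ δ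
            (one-of x≡ (p≢ y≡) (q≢ y≡) δ) (there (here refl)) γ′ (λ { refl → z′-misses x≡ (Via.pa δ) })
            where
            p≢ : y ≡ r ⊎ y ≡ s → p ≢ y
            p≢ (inj₁ refl) = p≢r
            p≢ (inj₂ refl) = p≢s
            q≢ : y ≡ r ⊎ y ≡ s → q ≢ y
            q≢ (inj₁ refl) = q≢r
            q≢ (inj₂ refl) = q≢s
            z′-misses : x ≡ p ⊎ x ≡ q → ¬ D adj z′ x
            z′-misses (inj₁ refl) = via-misses γ′ p∈ p≢r p≢s
            z′-misses (inj₂ refl) = via-misses γ′ q∈ q≢r q≢s

          -- The equations carry the case distinction into `Q`, so that `connector-or` computes and
          -- old links satisfy `In` trivially.
          go : ∀ pr₀ ps₀ qr₀ qs₀ → pr ≡ pr₀ → ps ≡ ps₀ → qr ≡ qr₀ → qs ≡ qs₀ → Third A (Limited A adj)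
          go (inj₂ (_ , δ)) _ _ _ refl _ _ _ = with-fourth (there (there (here refl))) (inj₁ refl) (inj₁ refl) δ
          go (inj₁ _) (inj₂ (_ , δ)) _ _ refl refl _ _ =
            with-fourth (there (there (there (here refl)))) (inj₁ refl) (inj₂ refl) δ
          go (inj₁ _) (inj₁ _) (inj₂ (_ , δ)) _ refl refl refl _ =
            with-fourth (there (there (there (there (here refl))))) (inj₂ refl) (inj₁ refl) δ
          go (inj₁ _) (inj₁ _) (inj₁ _) (inj₂ (_ , δ)) refl refl refl refl =
            with-fourth (there (there (there (there (there (here refl)))))) (inj₂ refl) (inj₂ refl) δ
          go (inj₁ _) (inj₁ _) (inj₁ _) (inj₁ _) refl refl refl refl =
            Q.choose-three {cs = z ∷ z′ ∷ []}
              (record { connectors = λ { (here refl) → z-connector ; (there (here refl)) → z′-connector }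
                      ; pq-in = here refl ; pr-in = tt ; ps-in = tt ; qr-in = tt ; qs-in = tt
                      ; rs-in = there (here refl) })
              γ (s≤s (s≤s z≤n)) (there (here refl)) γ′ (λ (_ , z′q) → via-misses γ′ q∈ q≢r q≢s z′q)

      -- The first three clauses treat a pair of opposite new edges, relabelled to take the places
      -- of `pq` and `rs`. In the remaining ones `rs` is old, and so is at least one of `pr`, `qs`
      -- and at least one of `ps`, `qr`.
      reduce-K4 : MixedInduction A → ∀ {p q r s z} → p ∈ A′ → q ∈ A′ → r ∈ A′ → s ∈ A′ → Via z p q →
        (pr : Link p r) (ps : Link p s) (qr : Link q r) (qs : Link q s) (rs : Link r s) →
        Third A (Limited A adj)
      reduce-K4 IH p∈ q∈ r∈ s∈ γ pr ps qr qs (inj₂ (_ , γ′)) = SplitK4.opposite IH p∈ q∈ r∈ s∈ γ pr ps qr qs γ′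
      reduce-K4 IH p∈ q∈ r∈ s∈ γ (inj₂ (_ , δ)) ps qr (inj₂ (_ , δ′)) rs =
        SplitK4.opposite IH p∈ r∈ q∈ s∈ δ (inj₂ (_ , γ)) ps (link-sym q∈ r∈ qr) rs δ′
      reduce-K4 IH p∈ q∈ r∈ s∈ γ pr (inj₂ (_ , δ)) (inj₂ (_ , δ′)) qs rs =
        SplitK4.opposite IH p∈ s∈ q∈ r∈ δ (inj₂ (_ , γ)) pr (link-sym q∈ s∈ qs) (link-sym r∈ s∈ rs) δ′
      reduce-K4 IH p∈ q∈ r∈ s∈ γ (inj₁ pr) (inj₁ ps) (inj₁ qr) (inj₁ qs) (inj₁ rs) =
        AtK4.choose-two IH record { p∈ = p∈ ; q∈ = q∈ ; r∈ = r∈ ; s∈ = s∈ ; pq = inj₂ (_ , γ) ; pr = inj₁ pr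
          ; ps = inj₁ ps ; qr = inj₁ qr ; qs = inj₁ qs ; rs = inj₁ rs } γ (here refl) tt tt tt tt tt
      reduce-K4 IH p∈ q∈ r∈ s∈ γ (inj₁ pr) (inj₂ (_ , δ)) (inj₁ qr) (inj₁ qs) (inj₁ rs) =
        SplitK4.few IH p∈ q∈ r∈ s∈ γ (inj₁ pr) (inj₂ (_ , δ)) (inj₁ qr) (inj₁ qs) (inj₁ rs)
          (inj₁ refl) (inj₂ refl) δ (here refl) (there (here refl)) γ
          tt (there (here refl)) tt tt tt
      reduce-K4 IH p∈ q∈ r∈ s∈ γ (inj₁ pr) (inj₁ ps) (inj₂ (_ , δ)) (inj₁ qs) (inj₁ rs) =
        SplitK4.few IH p∈ q∈ r∈ s∈ γ (inj₁ pr) (inj₁ ps) (inj₂ (_ , δ)) (inj₁ qs) (inj₁ rs)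
          (inj₂ refl) (inj₁ refl) δ (here refl) (there (here refl)) γ
          tt tt (there (here refl)) tt tt
      reduce-K4 IH p∈ q∈ r∈ s∈ γ (inj₂ (_ , δ)) (inj₁ ps) (inj₁ qr) (inj₁ qs) (inj₁ rs) =
        SplitK4.few IH p∈ q∈ r∈ s∈ γ (inj₂ (_ , δ)) (inj₁ ps) (inj₁ qr) (inj₁ qs) (inj₁ rs)
          (inj₁ refl) (inj₁ refl) δ (here refl) (there (here refl)) γ
          (there (here refl)) tt tt tt tt
      reduce-K4 IH p∈ q∈ r∈ s∈ γ (inj₂ (_ , δ)) (inj₂ (_ , δ′)) (inj₁ qr) (inj₁ qs) (inj₁ rs) =
        SplitK4.few IH p∈ q∈ r∈ s∈ γ (inj₂ (_ , δ)) (inj₂ (_ , δ′)) (inj₁ qr) (inj₁ qs) (inj₁ rs)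
          (inj₁ refl) (inj₁ refl) δ (here refl) (there (there (there (here refl)))) δ′
          (there (here refl)) (there (there (here refl))) tt tt tt
      reduce-K4 IH p∈ q∈ r∈ s∈ γ (inj₂ (_ , δ)) (inj₁ ps) (inj₂ (_ , δ′)) (inj₁ qs) (inj₁ rs) =
        SplitK4.few IH p∈ q∈ r∈ s∈ γ (inj₂ (_ , δ)) (inj₁ ps) (inj₂ (_ , δ′)) (inj₁ qs) (inj₁ rs)
          (inj₁ refl) (inj₁ refl) δ (there (here refl)) (there (there (here refl))) δ′
          (there (here refl)) tt (there (there (here refl))) tt tt
      reduce-K4 IH p∈ q∈ r∈ s∈ γ (inj₁ pr) (inj₁ ps) (inj₁ qr) (inj₂ (_ , δ)) (inj₁ rs) =
        SplitK4.few IH p∈ q∈ r∈ s∈ γ (inj₁ pr) (inj₁ ps) (inj₁ qr) (inj₂ (_ , δ)) (inj₁ rs)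
          (inj₂ refl) (inj₂ refl) δ (here refl) (there (here refl)) γ
          tt tt tt (there (here refl)) tt
      reduce-K4 IH p∈ q∈ r∈ s∈ γ (inj₁ pr) (inj₂ (_ , δ′)) (inj₁ qr) (inj₂ (_ , δ)) (inj₁ rs) =
        SplitK4.few IH p∈ q∈ r∈ s∈ γ (inj₁ pr) (inj₂ (_ , δ′)) (inj₁ qr) (inj₂ (_ , δ)) (inj₁ rs)
          (inj₂ refl) (inj₂ refl) δ (here refl) (there (there (there (here refl)))) δ′
          tt (there (there (here refl))) tt (there (here refl)) tt
      reduce-K4 IH p∈ q∈ r∈ s∈ γ (inj₁ pr) (inj₁ ps) (inj₂ (_ , δ′)) (inj₂ (_ , δ)) (inj₁ rs) =
        SplitK4.few IH p∈ q∈ r∈ s∈ γ (inj₁ pr) (inj₁ ps) (inj₂ (_ , δ′)) (inj₂ (_ , δ)) (inj₁ rs)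
          (inj₂ refl) (inj₂ refl) δ (there (here refl)) (there (there (here refl))) δ′
          tt tt (there (there (here refl))) (there (here refl)) tt

      choose-edge : MixedInduction A → Third A (Limited A adj)
      choose-edge IH with has-K4? {A = A′} {R = C adj′} (λ a b → (c , b) ∈ᵖ? adj′ a)
      ... | no none = keep-both IH (λ Q → none (_ , _ , _ , _ , Q))
      ... | yes (_ , _ , _ , _ , Q)
        with new-edge-first {R′ = Link} alive K4-free link-sym (λ _ _ → id) record
          { p∈ = p∈ ; q∈ = q∈ ; r∈ = r∈ ; s∈ = s∈ ; pq = to-link pq ; pr = to-link pr ; ps = to-link ps
          ; qr = to-link qr ; qs = to-link qs ; rs = to-link rs }
        where open K4 Q
      ... | _ , _ , _ , _ , Q′ , _ , γ = reduce-K4 IH p∈ q∈ r∈ s∈ γ pr ps qr qs rs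
        where open K4 Q′

    -- The case in which every d-edge is parallel to a c-edge.

    c-neighbours : V → List V
    c-neighbours x = map proj₂ (filter (λ p → proj₁ p ≟ᵗ c) (adj x))

    c-neighbour⁺ : ∀ {x y} → C adj x y → y ∈ c-neighbours x
    c-neighbour⁺ xy = ∈-map⁺ proj₂ (∈-filter⁺ (λ p → proj₁ p ≟ᵗ c) xy refl)

    c-neighbour⁻ : ∀ {x y} → y ∈ c-neighbours x → C adj x y
    c-neighbour⁻ {x} y∈ with ∈-map⁻ proj₂ y∈
    ... | p , p∈ , refl with ∈-filter⁻ (λ p → proj₁ p ≟ᵗ c) {xs = adj x} p∈
    ... | xp , refl = xp

    choose-independent : (∀ {x y} → x ∈ A → y ∈ A → D adj x y → C adj x y) → Third A (Limited A adj)
    choose-independent D⇒C with independent-third (suc (length A)) A c-neighbours ≤-refl unique record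
      { degree≤3 = λ x → ≤-trans (≤-reflexive (length-map proj₂ (filter _ (adj x))))
          (≤-trans (length-filter _ (adj x)) (degree≤3 x))
      ; symm = λ x∈ y∈ xy → c-neighbour⁺ (symm x∈ y∈ (c-neighbour⁻ xy))
      ; irrefl = λ x∈ xx → irrefl x∈ (c-neighbour⁻ xx)
      ; K4-free = λ Q → let open K4 Q in K4-free record
          { p∈ = p∈ ; q∈ = q∈ ; r∈ = r∈ ; s∈ = s∈ ; pq = c-neighbour⁻ pq ; pr = c-neighbour⁻ pr
          ; ps = c-neighbour⁻ ps ; qr = c-neighbour⁻ qr ; qs = c-neighbour⁻ qs ; rs = c-neighbour⁻ rs }
      }
    ... | third X uX X⊆ indX large = third X uX X⊆ (limited c-free d-free) large
      where
      c-free : ∀ {x y} → x ∈ X → y ∈ X → ¬ C adj x y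
      c-free x∈ y∈ xy = indX x∈ y∈ (c-neighbour⁺ xy)

      not-beside : ∀ {w x y} → w ∈ A → x ≡ w → x ∈ X → y ∈ X → x ≢ y → ¬ Near adj w y
      not-beside w∈ refl x∈ y∈ xy (inj₁ refl) = xy refl
      not-beside w∈ refl x∈ y∈ xy (inj₂ wy) = c-free x∈ y∈ (D⇒C w∈ (X⊆ y∈) wy)

      d-free : ∀ {w x y z} → w ∈ A → x ∈ X → y ∈ X → z ∈ X → x ≢ y → x ≢ z → y ≢ z →
               Near adj w x → Near adj w y → ¬ Near adj w z
      d-free w∈ x∈ y∈ z∈ xy xz yz (inj₁ eq) ny nz = not-beside w∈ eq x∈ y∈ xy ny
      d-free w∈ x∈ y∈ z∈ xy xz yz (inj₂ wx) (inj₁ eq) nz = not-beside w∈ eq y∈ z∈ yz nz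
      -- Each d-edge at `w` has a parallel c-edge, so two d-neighbours would occupy four ports.
      d-free {w} w∈ x∈ y∈ z∈ xy xz yz (inj₂ wx) (inj₂ wy) _ = no-four (degree≤3 w)
        wx wy (D⇒C w∈ (X⊆ x∈) wx) (D⇒C w∈ (X⊆ y∈) wy)
        (port-≢ xy) (λ ()) (port-≢ xy) (port-≢ (≢-sym xy)) (λ ()) (port-≢ xy)

  mixed-third : ∀ k A adj → length A < k → Unique A → Mixed A adj → Third A (Limited A adj)
  mixed-third (suc k) A adj (s≤s A≤k) unique G
    with Fin.any? (λ v → Fin.any? (λ e →
      (v ∈? A) ×-dec (e ∈? A) ×-dec ((d , e) ∈ᵖ? adj v) ×-dec ¬? ((c , e) ∈ᵖ? adj v)))
  ... | yes (v , e , v∈ , e∈ , ve , ¬ve) = ChooseEdge.choose-edge unique G v∈ e∈ ve ¬ve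
    λ A′ adj′ A′<A → mixed-third k A′ adj′ (<-≤-trans A′<A A≤k)
  ... | no none = choose-independent unique G λ {x} {y} x∈ y∈ xy →
    decidable-stable ((c , y) ∈ᵖ? adj x) (λ ¬xy → none (x , y , x∈ , y∈ , xy , ¬xy))

-- From graphs to port lists

⌊⌋-true : {P : Set} (P? : Dec P) → P → ⌊ P? ⌋ ≡ true
⌊⌋-true (yes _) _ = refl
⌊⌋-true (no ¬p) p = ⊥-elim (¬p p)

module _ {m : ℕ} where
  private
    V : Set
    V = Fin m

  Joined : Edge m → V → V → Set
  Joined f x y = (end₁ f ≡ x × end₂ f ≡ y) ⊎ (end₁ f ≡ y × end₂ f ≡ x)

  joins⇒joined : ∀ f x y → joins f x y ≡ true → Joined f x y
  joins⇒joined (edge a b _) x y eq with a ≟ x | b ≟ y | a ≟ y | b ≟ x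
  ... | yes ax | yes by | _ | _ = inj₁ (ax , by)
  ... | yes _ | no _ | yes ay | yes bx = inj₂ (ay , bx)
  ... | no _ | _ | yes ay | yes bx = inj₂ (ay , bx)

  joined⇒joins : ∀ f {x y} → Joined f x y → joins f x y ≡ true
  joined⇒joins (edge a b _) (inj₁ (refl , refl))
    rewrite ⌊⌋-true (a ≟ a) refl | ⌊⌋-true (b ≟ b) refl = refl
  joined⇒joins (edge a b _) (inj₂ (refl , refl))
    rewrite ⌊⌋-true (a ≟ a) refl | ⌊⌋-true (b ≟ b) refl = ∨-zeroʳ _

  joined⇒incident : ∀ f {x y} → Joined f x y → incident f x ≡ true
  joined⇒incident (edge a b _) (inj₁ (refl , _)) rewrite ⌊⌋-true (a ≟ a) refl = refl
  joined⇒incident (edge a b _) (inj₂ (_ , refl)) rewrite ⌊⌋-true (b ≟ b) refl = ∨-zeroʳ _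

  joined-unique : ∀ {f x y z} → x ≢ y → x ≢ z → Joined f x y → Joined f x z → y ≡ z
  joined-unique _ _ (inj₁ (_ , refl)) (inj₁ (_ , refl)) = refl
  joined-unique xy _ (inj₁ (_ , refl)) (inj₂ (_ , refl)) = ⊥-elim (xy refl)
  joined-unique _ xz (inj₂ (_ , refl)) (inj₁ (_ , refl)) = ⊥-elim (xz refl)
  joined-unique _ _ (inj₂ (refl , _)) (inj₂ (refl , _)) = refl

  ports : List (Edge m) → V → List (EType × V)
  ports [] x = []
  ports (edge a b t ∷ es) x with a ≟ x | b ≟ x
  ... | yes _ | _ = (t , b) ∷ ports es x
  ... | no _ | yes _ = (t , a) ∷ ports es x
  ... | no _ | no _ = ports es x

  length-ports : ∀ es x → length (ports es x) ≤ count (λ f → incident f x) es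
  length-ports [] x = z≤n
  length-ports (edge a b t ∷ es) x with a ≟ x | b ≟ x
  ... | yes _ | _ = s≤s (length-ports es x)
  ... | no _ | yes _ = s≤s (length-ports es x)
  ... | no _ | no _ = length-ports es x

  port⁻ : ∀ es {x y t} → (t , y) ∈ ports es x → ∃ λ f → f ∈ es × etype f ≡ t × Joined f x y
  port⁻ (edge a b t ∷ es) {x} xy with a ≟ x | b ≟ x | xy
  ... | yes ax | _ | here refl = _ , here refl , refl , inj₁ (ax , refl)
  ... | no _ | yes bx | here refl = _ , here refl , refl , inj₂ (refl , bx)
  ... | yes _ | _ | there xy′ = let f , f∈ , rest = port⁻ es xy′ in f , there f∈ , rest
  ... | no _ | yes _ | there xy′ = let f , f∈ , rest = port⁻ es xy′ in f , there f∈ , rest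
  ... | no _ | no _ | xy′ = let f , f∈ , rest = port⁻ es xy′ in f , there f∈ , rest

  port⁺ : ∀ {es f x y} → x ≢ y → f ∈ es → Joined f x y → (etype f , y) ∈ ports es x
  port⁺ {edge a b t ∷ es} {x = x} xy (here refl) j with a ≟ x | b ≟ x | j
  ... | yes _ | _ | inj₁ (_ , refl) = here refl
  ... | yes refl | _ | inj₂ (refl , _) = ⊥-elim (xy refl)
  ... | no ax | _ | inj₁ (eq , _) = ⊥-elim (ax eq)
  ... | no _ | yes _ | inj₂ (refl , _) = here refl
  ... | no _ | no bx | inj₂ (_ , eq) = ⊥-elim (bx eq)
  port⁺ {edge a b t ∷ es} {x = x} xy (there f∈) j with a ≟ x | b ≟ x
  ... | yes _ | _ = there (port⁺ xy f∈ j)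
  ... | no _ | yes _ = there (port⁺ xy f∈ j)
  ... | no _ | no _ = port⁺ xy f∈ j

  anyDEdge⇒port : ∀ es {x y} → x ≢ y → anyDEdge es x y ≡ true → (d , y) ∈ ports es x
  anyDEdge⇒port es {x} {y} xy eq = let f , f∈ , ft , j = go es eq in
    subst (λ t → (t , y) ∈ ports es x) ft (port⁺ xy f∈ j)
    where
    go : ∀ es → anyDEdge es x y ≡ true → ∃ λ f → f ∈ es × etype f ≡ d × Joined f x y
    go (f ∷ es) eq with etype f in teq | joins f x y in jeq
    ... | d | true = f , here refl , teq , joins⇒joined f x y jeq
    ... | d | false = let g , g∈ , rest = go es eq in g , there g∈ , rest
    ... | c | _ = let g , g∈ , rest = go es eq in g , there g∈ , rest

  count-disjoint : ∀ (p q : Edge m → Bool) → (∀ f → p f ≡ true → q f ≡ true → ⊥) → ∀ es →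
                   count p es + count q es ≡ count (λ f → p f ∨ q f) es
  count-disjoint p q dis [] = refl
  count-disjoint p q dis (f ∷ es) with p f in pf | q f in qf
  ... | true | true = ⊥-elim (dis f pf qf)
  ... | true | false = cong suc (count-disjoint p q dis es)
  ... | false | true = trans (+-suc _ _) (cong suc (count-disjoint p q dis es))
  ... | false | false = count-disjoint p q dis es

  count-mono : ∀ (p q : Edge m → Bool) → (∀ f → p f ≡ true → q f ≡ true) → ∀ es → count p es ≤ count q es
  count-mono p q imp [] = z≤n
  count-mono p q imp (f ∷ es) with p f in pf | q f in qf
  ... | true | true = s≤s (count-mono p q imp es)
  ... | true | false = case trans (sym (imp f pf)) qf of λ ()
  ... | false | true = m≤n⇒m≤1+n (count-mono p q imp es)
  ... | false | false = count-mono p q imp es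

  count-positive : ∀ (p : Edge m → Bool) {f es} → f ∈ es → p f ≡ true → 1 ≤ count p es
  count-positive p {es = g ∷ _} (here refl) pf rewrite pf = s≤s z≤n
  count-positive p {es = g ∷ _} (there f∈) pf with p g
  ... | true = s≤s z≤n
  ... | false = count-positive p f∈ pf

all-one : ∀ {i j k} → 1 ≤ i → 1 ≤ j → 1 ≤ k → i + j + k ≤ 3 → i ≡ 1 × j ≡ 1 × k ≡ 1
all-one {1} {1} {1} _ _ _ _ = refl , refl , refl
all-one {1} {1} {suc (suc _)} _ _ _ (s≤s (s≤s (s≤s ())))
all-one {1} {suc (suc j)} {suc k} _ _ _ (s≤s (s≤s (s≤s le))) = case subst (_≤ 0) (+-suc j k) le of λ ()
all-one {suc (suc i)} {suc j} {suc k} _ _ _ (s≤s (s≤s le)) =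
  case subst (_≤ 1) (trans (cong (_+ suc k) (+-suc i j)) (cong suc (+-suc (i + j) k))) le of λ { (s≤s ()) }

-- Subsets as duplicate-free lists.

members : ∀ {m} → Subset m → List (Fin m)
members [] = []
members (true ∷ P) = zero ∷ map suc (members P)
members (false ∷ P) = map suc (members P)

length-members : ∀ {m} (P : Subset m) → length (members P) ≡ ∣ P ∣
length-members [] = refl
length-members (true ∷ P) = cong suc (trans (length-map suc (members P)) (length-members P))
length-members (false ∷ P) = trans (length-map suc (members P)) (length-members P)

members-unique : ∀ {m} (P : Subset m) → Unique (members P)
members-unique [] = []
members-unique (true ∷ P) = ¬Any⇒All¬ _ zero∉ ∷ Unique.map⁺ suc-injective (members-unique P)
  where
  zero∉ : zero ∉ map suc (members P)
  zero∉ z∈ with ∈-map⁻ suc z∈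
  ... | _ , _ , ()
members-unique (false ∷ P) = Unique.map⁺ suc-injective (members-unique P)

members⁺ : ∀ {m} {P : Subset m} {x} → x ∈ˢ P → x ∈ members P
members⁺ {P = true ∷ P} Vec.here = here refl
members⁺ {P = true ∷ P} (Vec.there x∈) = there (∈-map⁺ suc (members⁺ x∈))
members⁺ {P = false ∷ P} (Vec.there x∈) = ∈-map⁺ suc (members⁺ x∈)

members⁻ : ∀ {m} (P : Subset m) {x} → x ∈ members P → x ∈ˢ P
members⁻ (true ∷ P) (here refl) = Vec.here
members⁻ (true ∷ P) (there x∈) with ∈-map⁻ suc x∈
... | y , y∈ , refl = Vec.there (members⁻ P y∈)
members⁻ (false ∷ P) x∈ with ∈-map⁻ suc x∈
... | y , y∈ , refl = Vec.there (members⁻ P y∈)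

-- Turns a violated cardinality bound into the three distinct members that `d-free` excludes.
three-members : ∀ {m} (P : Subset m) → 2 < ∣ P ∣ →
  ∃ λ x → ∃ λ y → ∃ λ z → x ∈ˢ P × y ∈ˢ P × z ∈ˢ P × x ≢ y × x ≢ z × y ≢ z
three-members P large with members P | members-unique P | members⁻ P | length-members P
... | [] | _ | _ | eq = case subst (2 <_) (sym eq) large of λ ()
... | _ ∷ [] | _ | _ | eq = case subst (2 <_) (sym eq) large of λ { (s≤s ()) }
... | _ ∷ _ ∷ [] | _ | _ | eq = case subst (2 <_) (sym eq) large of λ { (s≤s (s≤s ())) }
... | x ∷ y ∷ z ∷ _ | (xy ∷ xz ∷ _) ∷ (yz ∷ _) ∷ _ | in-P | _ =
  x , y , z , in-P (here refl) , in-P (there (here refl)) , in-P (there (there (here refl))) , xy , xz , yz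

-- Graphs as mixed port lists, and back to subsets.

module _ (G : Graph) (loopless : Loopless G) (subcubic : MaxDegreeAtMost3 G) where
  private
    V : Set
    V = Fin (n G)

    adj : Ports-of
    adj = ports (E G)

  open DecMembership (_≟_ {n G}) using (_∈?_)

  joined-≢ : ∀ {f x y} → f ∈ E G → Joined f x y → x ≢ y
  joined-≢ f∈ (inj₁ (refl , refl)) eq = All.lookup loopless f∈ eq
  joined-≢ f∈ (inj₂ (refl , refl)) eq = All.lookup loopless f∈ (sym eq)

  few-ports : ∀ x → length (adj x) ≤ 3
  few-ports x = ≤-trans (length-ports (E G) x) (subcubic x)

  port-sym : ∀ {t x y} → (t , y) ∈ adj x → (t , x) ∈ adj y
  port-sym xy with port⁻ (E G) xy
  ... | f , f∈ , refl , inj₁ (a , b) = port⁺ (≢-sym (joined-≢ f∈ (inj₁ (a , b)))) f∈ (inj₂ (a , b))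
  ... | f , f∈ , refl , inj₂ (a , b) = port⁺ (≢-sym (joined-≢ f∈ (inj₂ (a , b)))) f∈ (inj₁ (a , b))

  port-irrefl : ∀ {t x} → (t , x) ∉ adj x
  port-irrefl xx with port⁻ (E G) xx
  ... | f , f∈ , _ , j = joined-≢ f∈ j refl

  -- No edge joins `x` to two of `p`, `q`, `r`, so the three multiplicities add up to at most
  -- `degree G x`. All are positive and their sum is at most 3.
  single-edges : ∀ {x p q r} → p ≢ q → p ≢ r → q ≢ r → C adj x p → C adj x q → C adj x r →
                 mult G x p ≡ 1 × mult G x q ≡ 1 × mult G x r ≡ 1
  single-edges {x} {p} {q} {r} pq pr qr xp xq xr = all-one (present xp) (present xq) (present xr) (begin
    mult G x p + mult G x q + mult G x r ≡⟨ cong (_+ mult G x r) (count-disjoint (to p) (to q) (apart xp xq pq) (E G)) ⟩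
    count (λ f → to p f ∨ to q f) (E G) + mult G x r
      ≡⟨ count-disjoint (λ f → to p f ∨ to q f) (to r) p∨q-apart-r (E G) ⟩
    count (λ f → (to p f ∨ to q f) ∨ to r f) (E G) ≤⟨ count-mono _ (λ f → incident f x) incident-x (E G) ⟩
    degree G x ≤⟨ subcubic x ⟩
    3 ∎)
    where
    open ≤-Reasoning
    to : V → Edge (n G) → Bool
    to y f = joins f x y

    x≢ : ∀ {y} → C adj x y → x ≢ y
    x≢ xy refl = port-irrefl xy

    present : ∀ {y} → C adj x y → 1 ≤ mult G x y
    present {y} xy = let f , f∈ , _ , j = port⁻ (E G) xy in count-positive (to y) f∈ (joined⇒joins f j)

    apart : ∀ {y z} → C adj x y → C adj x z → y ≢ z → ∀ f → to y f ≡ true → to z f ≡ true → ⊥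
    apart {y} {z} xy xz y≢z f fy fz =
      y≢z (joined-unique {f = f} (x≢ xy) (x≢ xz) (joins⇒joined f x y fy) (joins⇒joined f x z fz))

    p∨q-apart-r : ∀ f → to p f ∨ to q f ≡ true → to r f ≡ true → ⊥
    p∨q-apart-r f fpq fr with to p f in fp | to q f in fq
    ... | true | _ = apart xp xr pr f fp fr
    ... | false | true = apart xq xr qr f fq fr

    incident-x : ∀ f → (to p f ∨ to q f) ∨ to r f ≡ true → incident f x ≡ true
    incident-x f eq with to p f in fp | to q f in fq | to r f in fr
    ... | true | _ | _ = joined⇒incident f (joins⇒joined f x p fp)
    ... | false | true | _ = joined⇒incident f (joins⇒joined f x q fq)
    ... | false | false | true = joined⇒incident f (joins⇒joined f x r fr)

  -- Three c-edges fill the degree of a corner, which leaves no parallel edge and no edge out of the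
  -- K4.
  K4⇒component : ∀ {p q r s} → K4 (allFin (n G)) (C adj) p q r s → HasCK4Component G
  K4⇒component {p} {q} {r} {s} Q = p , q , r , s , (p≢q , p≢r , p≢s , q≢r , q≢s , r≢s) ,
    (proj₁ at-p , proj₁ (proj₂ at-p) , proj₂ (proj₂ at-p) ,
      proj₁ (proj₂ at-q) , proj₂ (proj₂ at-q) , proj₂ (proj₂ at-r)) ,
    All.tabulate λ {f} f∈ touch → closed f∈ touch
    where
    open K4 Q
    c-≢ : ∀ {x y} → C adj x y → x ≢ y
    c-≢ xy refl = port-irrefl xy
    p≢q = c-≢ pq
    p≢r = c-≢ pr
    p≢s = c-≢ ps
    q≢r = c-≢ qr
    q≢s = c-≢ qs
    r≢s = c-≢ rs
    at-p = single-edges q≢r q≢s r≢s pq pr ps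
    at-q = single-edges p≢r p≢s r≢s (port-sym pq) qr qs
    at-r = single-edges p≢q p≢s q≢s (port-sym pr) (port-sym qr) rs

    Corner : V → Set
    Corner = InFour G p q r s

    corner-ports : ∀ {x y z w} → y ≢ z → y ≢ w → z ≢ w → C adj x y → C adj x z → C adj x w →
      Corner y → Corner z → Corner w → ∀ {t u} → (t , u) ∈ adj x → t ≡ c × Corner u
    corner-ports {x} yz yw zw xy xz xw cy cz cw xu with Ports.only-three (few-ports x) xy xz xw
      (port-≢ yz) (port-≢ yw) (port-≢ zw) xu
    ... | here refl = refl , cy
    ... | there (here refl) = refl , cz
    ... | there (there (here refl)) = refl , cw

    corner-only : ∀ {x} → Corner x → ∀ {t u} → (t , u) ∈ adj x → t ≡ c × Corner u
    corner-only (inj₁ refl) = corner-ports q≢r q≢s r≢s pq pr ps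
      (inj₂ (inj₁ refl)) (inj₂ (inj₂ (inj₁ refl))) (inj₂ (inj₂ (inj₂ refl)))
    corner-only (inj₂ (inj₁ refl)) = corner-ports p≢r p≢s r≢s (port-sym pq) qr qs
      (inj₁ refl) (inj₂ (inj₂ (inj₁ refl))) (inj₂ (inj₂ (inj₂ refl)))
    corner-only (inj₂ (inj₂ (inj₁ refl))) = corner-ports p≢q p≢s q≢s (port-sym pr) (port-sym qr) rs
      (inj₁ refl) (inj₂ (inj₁ refl)) (inj₂ (inj₂ (inj₂ refl)))
    corner-only (inj₂ (inj₂ (inj₂ refl))) = corner-ports p≢q p≢r q≢r (port-sym ps) (port-sym qs) (port-sym rs)
      (inj₁ refl) (inj₂ (inj₁ refl)) (inj₂ (inj₂ (inj₁ refl)))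

    closed : ∀ {f} → f ∈ E G → Corner (end₁ f) ⊎ Corner (end₂ f) →
             etype f ≡ c × Corner (end₁ f) × Corner (end₂ f)
    closed f∈ (inj₁ c₁) =
      let t≡c , c₂ = corner-only c₁ (port⁺ (All.lookup loopless f∈) f∈ (inj₁ (refl , refl))) in t≡c , c₁ , c₂
    closed f∈ (inj₂ c₂) =
      let t≡c , c₁ = corner-only c₂ (port⁺ (≢-sym (All.lookup loopless f∈)) f∈ (inj₂ (refl , refl))) in
      t≡c , c₁ , c₂

  mixed : ¬ HasCK4Component G → Mixed (allFin (n G)) adj
  mixed no-K4 = record
    { degree≤3 = few-ports
    ; symm = λ _ _ → port-sym
    ; irrefl = λ _ → port-irrefl
    ; K4-free = no-K4 ∘ K4⇒component
    }

  to-subset : List V → Subset (n G)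
  to-subset X = Vec.tabulate (λ x → ⌊ x ∈? X ⌋)

  tabulate-∈⁻ : ∀ {P : V → Bool} {x} → x ∈ˢ Vec.tabulate P → P x ≡ true
  tabulate-∈⁻ {P} {x} x∈ = trans (sym (lookup∘tabulate P x)) ([]=⇒lookup x∈)

  to-subset⁻ : ∀ {X x} → x ∈ˢ to-subset X → x ∈ X
  to-subset⁻ {X} {x} x∈ with x ∈? X | tabulate-∈⁻ {P = λ x → ⌊ x ∈? X ⌋} x∈
  ... | yes x∈X | _ = x∈X

  to-subset⁺ : ∀ {X x} → x ∈ X → x ∈ˢ to-subset X
  to-subset⁺ {X} {x} x∈ = lookup⇒[]= x _ (trans (lookup∘tabulate _ x) (⌊⌋-true (x ∈? X) x∈))

  Nd⇒near : ∀ {w x} → x ∈ˢ Nd G w → Near adj w x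
  Nd⇒near {w} {x} x∈ with x ≟ w | tabulate-∈⁻ {P = λ x → ⌊ x ≟ w ⌋ ∨ anyDEdge (E G) w x} x∈
  ... | yes eq | _ = inj₁ eq
  ... | no x≢w | eq = inj₂ (anyDEdge⇒port (E G) (≢-sym x≢w) eq)

  limited⇒two-limited : ∀ {X} → Limited (allFin (n G)) adj X → TwoLimited G (to-subset X)
  limited⇒two-limited {X} (limited c-free d-free) = All.tabulate c-edges , λ w →
    decidable-stable (∣ to-subset X ∩ Nd G w ∣ ≤? 2) λ large → crowded w (≰⇒> large)
    where
    c-edges : ∀ {f} → f ∈ E G → etype f ≡ c → ¬ (end₁ f ∈ˢ to-subset X × end₂ f ∈ˢ to-subset X)
    c-edges f∈ refl (x∈ , y∈) = c-free (to-subset⁻ x∈) (to-subset⁻ y∈)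
      (port⁺ (All.lookup loopless f∈) f∈ (inj₁ (refl , refl)))

    crowded : ∀ w → ¬ 2 < ∣ to-subset X ∩ Nd G w ∣
    crowded w large with three-members _ large
    ... | x , y , z , x∈ , y∈ , z∈ , xy , xz , yz =
      let x∈X , x∈N = x∈p∩q⁻ _ _ x∈ ; y∈X , y∈N = x∈p∩q⁻ _ _ y∈ ; z∈X , z∈N = x∈p∩q⁻ _ _ z∈ in
      d-free (∈-allFin w) (to-subset⁻ x∈X) (to-subset⁻ y∈X) (to-subset⁻ z∈X) xy xz yz
        (Nd⇒near x∈N) (Nd⇒near y∈N) (Nd⇒near z∈N)

  length≤∣to-subset∣ : ∀ {X} → Unique X → length X ≤ ∣ to-subset X ∣
  length≤∣to-subset∣ {X} uX = ≤-trans (unique-⊆⇒length≤ uX (members⁺ ∘ to-subset⁺))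
    (≤-reflexive (length-members (to-subset X)))

theorem2p1 : (G : Graph) → Loopless G → MaxDegreeAtMost3 G → ¬ HasCK4Component G
    → Σ (Subset (n G)) (λ X → TwoLimited G X × n G ≤ 3 * ∣ X ∣)
theorem2p1 G loopless subcubic no-K4
  with mixed-third _ (allFin (n G)) (ports (E G)) ≤-refl (Unique.allFin⁺ (n G)) (mixed G loopless subcubic no-K4)
... | ShortLists.third X uX _ lim large =
  to-subset G loopless subcubic X , limited⇒two-limited G loopless subcubic lim , (begin
    n G ≡⟨ length-tabulate id ⟨
    length (allFin (n G)) ≤⟨ large ⟩
    3 * length X ≤⟨ *-monoʳ-≤ 3 (length≤∣to-subset∣ G loopless subcubic uX) ⟩
    3 * ∣ to-subset G loopless subcubic X ∣ ∎)
  where open ≤-Reasoning
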